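{- Let $q$ be a prime power and $m$ a positive integer. If there exists an $[\mathcal F,k,\delta]_{q^m}$ code, where $\mathcal F=[\gamma_0,\gamma_1,\ldots,\gamma_{n-1}]$ is a Ferrers diagram, then there exists an $[\mathcal F',mk,\delta]_q$ code, where $\mathcal F'=[m\gamma_0,m\gamma_1,\ldots,m\gamma_{n-1}]$.
   Context: Ferrers diagrams. For positive integers $a,n$, an $a\times n$ Ferrers diagram is an $a\times n$ array of dots and empty cells such that all dots are shifted to the right, the number of dots in each row is at most the number of dots in the previous row, the first row has $n$ dots and the rightmost column has $a$ dots. It is identified with its column cardinalities: $\mathcal F=[\gamma_0,\gamma_1,\ldots,\gamma_{n-1}]$ with $1\leq\gamma_0\leq\gamma_1\leq\cdots\leq\gamma_{n-1}=a$, where the $(j+1)$-th column from the left has exactly $\gamma_j$ dots, located in its top $\gamma_j$ cells. Codes. For an $a\times n$ Ferrers diagram $\mathcal F$ and a prime power $Q$, an $[\mathcal F,k,\delta]_Q$ code (Ferrers diagram rank-metric code) is a $k$-dimensional $\mathbb F_Q$-linear subspace of $\mathbb F_Q^{a\times n}$ with minimum rank distance $\delta$ (the minimum of the ranks over $\mathbb F_Q$ of its nonzero matrices), such that in every matrix of the code all entries at positions not in $\mathcal F$ are zero. -}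

module Defs where

open import Algebra.Bundles using (CommutativeRing)
import Algebra.Properties.Monoid.Sum as Sum
open import Data.Fin.Base as Fin using (Fin; toℕ)
open import Data.Nat.Base using (ℕ; suc; _*_; _^_; _≤_; _<_; NonZero; >-nonZero⁻¹)
open import Data.Nat.Properties using (*-monoʳ-≤; *-mono-≤)
open import Data.Nat.Primality using (Prime)
open import Data.Product using (∃-syntax; _×_; _,_)
open import Data.Vec.Functional using (Vector)
open import Function.Bundles using (Bijection)
open import Level using (0ℓ)
open import Relation.Binary.PropositionalEquality using (_≡_; cong; setoid)
open import Relation.Nullary using (¬_)
open import Relation.Unary using (Pred; _∈_)

IsPrimePower : ℕ → Set
IsPrimePower Q = ∃[ p ] ∃[ e ] (Prime p × 1 ≤ e × Q ≡ p ^ e)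

-- The diagram is given by its column cardinalities; columns are numbered from
-- the left, starting at 0.  The premise of `γ-last` singles out the rightmost one.
record FerrersDiagram (a n : ℕ) : Set where
  field
    a-positive : 1 ≤ a
    n-positive : 1 ≤ n
    γ          : Vector ℕ n
    γ-positive : ∀ j → 1 ≤ γ j
    γ-monotone : ∀ {i j} → i Fin.≤ j → γ i ≤ γ j
    γ-last     : ∀ j → suc (toℕ j) ≡ n → γ j ≡ a

  -- Column j occupies its top γ j cells; row 0 is the top row.
  Dot : Fin a × Fin n → Set
  Dot (i , j) = toℕ i < γ j

scale : ∀ m .{{_ : NonZero m}} {a n} → FerrersDiagram a n → FerrersDiagram (m * a) n
scale m 𝓕 = record
  { a-positive = *-mono-≤ (>-nonZero⁻¹ m) a-positive
  ; n-positive = n-positive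
  ; γ          = λ j → m * γ j
  ; γ-positive = λ j → *-mono-≤ (>-nonZero⁻¹ m) (γ-positive j)
  ; γ-monotone = λ i≤j → *-monoʳ-≤ m (γ-monotone i≤j)
  ; γ-last     = λ j eq → cong (m *_) (γ-last j eq)
  }
  where open FerrersDiagram 𝓕

-- A field with exactly Q elements, elements being counted up to the ring's
-- equality _≈_.
record FiniteField (Q : ℕ) : Set₁ where
  field
    commutativeRing : CommutativeRing 0ℓ 0ℓ

  open CommutativeRing commutativeRing public
    renaming (_*_ to _·_; setoid to ≈-setoid)

  field
    1≉0         : ¬ (1# ≈ 0#)
    inverse     : ∀ x → ¬ (x ≈ 0#) → ∃[ y ] (x · y ≈ 1#)
    cardinality : Bijection (setoid (Fin Q)) ≈-setoid

module LinearAlgebra {Q : ℕ} (K : FiniteField Q) where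
  open FiniteField K
  open Sum +-monoid using (sum-syntax)

  module _ {I : Set} where

    infix 4 _≋_

    _≋_ : (u v : I → Carrier) → Set
    u ≋ v = ∀ x → u x ≈ v x

    𝟎 : I → Carrier
    𝟎 _ = 0#

    record IsSubspace (W : Pred (I → Carrier) 0ℓ) : Set where
      field
        resp     : ∀ {u v} → u ≋ v → u ∈ W → v ∈ W
        0-closed : 𝟎 ∈ W
        +-closed : ∀ {u v} → u ∈ W → v ∈ W → (λ x → u x + v x) ∈ W
        ·-closed : ∀ c {v} → v ∈ W → (λ x → c · v x) ∈ W

    lincomb : ∀ {k} → Vector Carrier k → Vector (I → Carrier) k → I → Carrier
    lincomb {k} c v x = ∑[ i < k ] (c i · v i x)

    Span : ∀ {k} → Vector (I → Carrier) k → Pred (I → Carrier) 0ℓ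
    Span v w = ∃[ c ] (w ≋ lincomb c v)

    LinearlyIndependent : ∀ {k} → Vector (I → Carrier) k → Set
    LinearlyIndependent v = ∀ c → lincomb c v ≋ 𝟎 → ∀ i → c i ≈ 0#

    record HasDimension (W : Pred (I → Carrier) 0ℓ) (k : ℕ) : Set where
      field
        basis       : Vector (I → Carrier) k
        basis∈      : ∀ i → basis i ∈ W
        independent : LinearlyIndependent basis
        spanning    : ∀ {w} → w ∈ W → w ∈ Span basis

  Matrix : ℕ → ℕ → Set
  Matrix a n = Fin a × Fin n → Carrier

  columns : ∀ {a n} → Matrix a n → Vector (Fin a → Carrier) n
  columns M j i = M (i , j)

  HasRank : ∀ {a n} → Matrix a n → ℕ → Set
  HasRank M r = HasDimension (Span (columns M)) r

  record HasMinimumRankDistance {a n} (C : Pred (Matrix a n) 0ℓ) (δ : ℕ) : Set where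
    field
      attained : ∃[ M ] (M ∈ C × ¬ (M ≋ 𝟎) × HasRank M δ)
      minimal  : ∀ {M r} → M ∈ C → ¬ (M ≋ 𝟎) → HasRank M r → δ ≤ r

  record IsFerrersCode {a n} (𝓕 : FerrersDiagram a n) (k δ : ℕ)
                       (C : Pred (Matrix a n) 0ℓ) : Set where
    open FerrersDiagram 𝓕 using (Dot)
    field
      isSubspace : IsSubspace C
      dimension  : HasDimension C k
      distance   : HasMinimumRankDistance C δ
      support    : ∀ {M} → M ∈ C → ∀ p → ¬ Dot p → M p ≈ 0#

-- An [𝓕, k, δ]_Q code.  Finite fields of the same order are isomorphic, so 𝔽_Q is
-- represented by an arbitrary field with Q elements, carried along as part of the code.
record FerrersCode {a n} (𝓕 : FerrersDiagram a n) (k δ Q : ℕ) : Set₁ where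
  field
    𝔽    : FiniteField Q
    code : Pred (LinearAlgebra.Matrix 𝔽 a n) 0ℓ
    isFerrersCode : LinearAlgebra.IsFerrersCode 𝔽 𝓕 k δ code

{-# OPTIONS --safe #-}
module Submission where

-- The elements x with x ^ q ≈ x form a subfield F of K = 𝔽_{q^m} with exactly q elements:
-- they are the roots of X^q - X, and the remaining elements are roots of a polynomial of
-- degree q^m - q.  Hence K has an F-basis of m elements, and replacing every entry of a
-- matrix over K by the column of its m coordinates is F-linear, is compatible with the
-- diagrams and never lowers the rank.  It can raise it, so the distance of the expanded
-- code may exceed δ.  Therefore the code is first changed by column operations that
-- preserve rank and diagram (earlier columns, which have fewer dots, are added to later
-- ones) and that leave exactly δ nonzero columns in a chosen codeword of rank δ: the
-- expansion of that codeword then has rank exactly δ.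

open import Defs
open import Algebra.Bundles using (CommutativeMonoid; CommutativeRing; RawRing)
import Algebra.Morphism.RingMonomorphism as RingMonomorphism
open import Algebra.Morphism.Structures using (module RingMorphisms)
import Algebra.Properties.AbelianGroup as AbelianGroupProperties
import Algebra.Properties.CommutativeMonoid.Sum as CommutativeMonoidSum
import Algebra.Properties.CommutativeSemigroup as CommutativeSemigroupProperties
import Algebra.Properties.CommutativeSemiring.Binomial as Binomial
import Algebra.Properties.CommutativeSemiring.Exp as Exp
import Algebra.Properties.Group as GroupProperties
import Algebra.Properties.Ring as RingProperties
import Algebra.Properties.Semiring.Mult as Mult
import Algebra.Properties.Semiring.Sum as SemiringSum
import Algebra.Solver.Ring.NaturalCoefficients.Default as SemiringSolver
open import Data.Fin.Base as Fin using
  ( Fin; zero; suc; toℕ; fromℕ; fromℕ<; inject; inject₁; join; splitAt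
  ; combine; quotient; remainder; remQuot; finToFun; funToFin; _↑ˡ_; _↑ʳ_ )
open import Data.Fin.Induction using (<-wellFounded; >-wellFounded)
open import Data.Fin.Permutation using (Permutation′; permutation; _⟨$⟩ʳ_)
import Data.Fin.Properties as Fin
open import Data.Nat.Base as ℕ using (ℕ; zero; suc; NonZero; z≤n; s≤s)
open import Data.Nat.Combinatorics using (_C_; nCn≡1; nCk≡nC[n∸k]; nCk≡n!/k![n-k]!; k![n∸k]!∣n!)
open import Data.Nat.DivMod using (m/n*n≡m)
open import Data.Nat.Divisibility using (_∣_; divides; ∣⇒≤; m∣m*n)
open import Data.Nat.Primality using (Prime; euclidsLemma; prime⇒nonZero; prime⇒nonTrivial)
import Data.Nat.Properties as ℕ
import Data.Nat.Solver as ℕSolver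
open import Data.Product using (∃-syntax; Σ-syntax; _×_; _,_; proj₁; proj₂; uncurry)
open import Data.Sum using (_⊎_; inj₁; inj₂; [_,_]′)
open import Data.Unit.Base using (⊤; tt)
open import Data.Vec.Base using (Vec; []; _∷_; _++_) renaming (replicate to vreplicate)
open import Data.Vec.Functional using (Vector; replicate; tail)
open import Function.Base using (_∘_)
open import Function.Bundles using (Bijection)
open import Induction.WellFounded using (Acc; acc)
open import Level using (0ℓ)
open import Relation.Binary.Definitions using (Decidable; tri<; tri≈; tri>)
open import Relation.Binary.PropositionalEquality as ≡ using (_≡_; _≢_)
open import Relation.Nullary using (¬_; Dec; yes; no; contradiction; ¬?)
import Relation.Nullary.Decidable as Dec
open import Relation.Unary as Unary using (Pred; _∈_)

-- Expansion can raise the rank because columns that are dependent over K may have no relation with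
-- coefficients in F. A zero column stays zero, however, and columns independent over K stay
-- independent over F. So a codeword whose nonzero columns are independent over K keeps its rank,
-- and this is the shape that the column operations produce. The expansion is handled through its
-- inverse, contraction, which reads m coordinates as one element of K. Contraction is visibly
-- F-linear, and injective because the basis is independent, whereas coordinates are picked
-- separately for each element by an existence statement. All dimension arguments rest on
-- finiteness: spans are searched exhaustively, and dimensions are compared by counting vectors.
-- This is why a subfield carries an enumeration of its members.

-- Prime divisors of factorials and binomial coefficients

prime∣!⇒≤ : ∀ {p} → Prime p → ∀ k → p ∣ k ℕ.! → p ℕ.≤ k
prime∣!⇒≤ {p} pr zero p∣1 =
  contradiction (∣⇒≤ p∣1) (ℕ.<⇒≱ (ℕ.nonTrivial⇒n>1 p {{prime⇒nonTrivial pr}}))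
prime∣!⇒≤ pr (suc k) p∣k! with euclidsLemma (suc k) (k ℕ.!) pr p∣k!
... | inj₁ p∣1+k = ∣⇒≤ p∣1+k
... | inj₂ p∣k!′ = ℕ.m≤n⇒m≤1+n (prime∣!⇒≤ pr k p∣k!′)

-- p divides p! = (p C k) · (k! (p - k)!), but it cannot divide the second factor, a product of
-- numbers below p.
prime∣binomial : ∀ {p k} → Prime p → 0 ℕ.< k → k ℕ.< p → p ∣ p C k
prime∣binomial {p@(suc p′)} {k} pr 0<k k<p =
  [ (λ p∣pCk → p∣pCk) , (λ p∣d → contradiction p∣d p∤d) ]′
    (euclidsLemma (p C k) (k ℕ.! ℕ.* (p ℕ.∸ k) ℕ.!) pr p∣pCk*d)
  where
  instance
    d≢0 : NonZero (k ℕ.! ℕ.* (p ℕ.∸ k) ℕ.!)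
    d≢0 = ℕ._!*_!≢0 k (p ℕ.∸ k)
  p∣pCk*d : p ∣ (p C k) ℕ.* (k ℕ.! ℕ.* (p ℕ.∸ k) ℕ.!)
  p∣pCk*d = ≡.subst (p ∣_)
    (≡.sym (≡.trans (≡.cong (ℕ._* (k ℕ.! ℕ.* (p ℕ.∸ k) ℕ.!)) (nCk≡n!/k![n-k]! (ℕ.<⇒≤ k<p)))
                    (m/n*n≡m (k![n∸k]!∣n! (ℕ.<⇒≤ k<p)))))
    (m∣m*n (p′ ℕ.!))
  p∤d : ¬ p ∣ k ℕ.! ℕ.* (p ℕ.∸ k) ℕ.!
  p∤d p∣d with euclidsLemma (k ℕ.!) ((p ℕ.∸ k) ℕ.!) pr p∣d
  ... | inj₁ p∣k! = contradiction (prime∣!⇒≤ pr k p∣k!) (ℕ.<⇒≱ k<p)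
  ... | inj₂ p∣[p-k]! =
    contradiction (prime∣!⇒≤ pr (p ℕ.∸ k) p∣[p-k]!) (ℕ.<⇒≱ (ℕ.∸-monoʳ-< 0<k (ℕ.<⇒≤ k<p)))

module _ {c ℓ} (M : CommutativeMonoid c ℓ) where
  open CommutativeMonoid M
  open CommutativeMonoidSum M

  -- Applied to the multiplicative monoid of a field: the exceptional index is that of zero, and the
  -- remaining ones yield a power of x.
  sum-almost-constant : ∀ {n n′} → n ≡ suc n′ → (t : Vector Carrier n) (i : Fin n) (x : Carrier) →
    t i ≈ ε → (∀ j → j ≢ i → t j ≈ x) → sum t ≈ sum (replicate n′ x)
  sum-almost-constant ≡.refl t i x tᵢ≈ε t≈x =
    trans (sum-remove {i = i} t)
    (trans (∙-cong tᵢ≈ε (sum-cong-≋ (λ j → t≈x (Fin.punchIn i j) (Fin.punchInᵢ≢i i j))))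
           (identityˡ _))

-- Finite fields

module FiniteFieldProperties {Q : ℕ} (K : FiniteField Q) where
  open FiniteField K hiding (_≉_; zero)
  open Bijection cardinality using (strictlySurjective)
    renaming (to to element; injective to element-injective) public
  open Exp commutativeSemiring
  open Mult semiring using (×-assoc-*; ×1-homo-*; ×-homo-1; ×-congˡ)
    renaming (_×_ to _•_; ×-cong to ×-cong₂)
  open SemiringSum semiring
  module Prod = CommutativeMonoidSum *-commutativeMonoid
  open GroupProperties +-group using (∙-cancelˡ)
  open import Relation.Binary.Reasoning.Setoid ≈-setoid

  infix 4 _≟_ _≉_

  _≉_ : Carrier → Carrier → Set
  x ≉ y = ¬ (x ≈ y)

  index : Carrier → Fin Q
  index x = proj₁ (strictlySurjective x)

  element-index : ∀ x → element (index x) ≈ x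
  element-index x = proj₂ (strictlySurjective x)

  index-cong : ∀ {x y} → x ≈ y → index x ≡ index y
  index-cong x≈y = element-injective (trans (element-index _) (trans x≈y (sym (element-index _))))

  index-element : ∀ i → index (element i) ≡ i
  index-element i = element-injective (element-index _)

  index-injective : ∀ {x y} → index x ≡ index y → x ≈ y
  index-injective eq =
    trans (sym (element-index _)) (trans (reflexive (≡.cong element eq)) (element-index _))

  _≟_ : Decidable _≈_
  x ≟ y with index x Fin.≟ index y
  ... | yes eq = yes (index-injective eq)
  ... | no neq = no (neq ∘ index-cong)

  ·-cancelˡ : ∀ {x y z} → x ≉ 0# → x · y ≈ x · z → y ≈ z
  ·-cancelˡ {x} {y} {z} x≉0 xy≈xz with inverse x x≉0
  ... | x⁻¹ , xx⁻¹≈1 = begin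
    y              ≈⟨ cancel y ⟨
    x⁻¹ · (x · y)  ≈⟨ *-congˡ xy≈xz ⟩
    x⁻¹ · (x · z)  ≈⟨ cancel z ⟩
    z              ∎
    where
    cancel : ∀ w → x⁻¹ · (x · w) ≈ w
    cancel w = trans (sym (*-assoc _ _ _))
      (trans (*-congʳ (trans (*-comm _ _) xx⁻¹≈1)) (*-identityˡ w))

  ·-≉0 : ∀ {x y} → x ≉ 0# → y ≉ 0# → x · y ≉ 0#
  ·-≉0 x≉0 y≉0 xy≈0 = y≉0 (·-cancelˡ x≉0 (trans xy≈0 (sym (zeroʳ _))))

  ·-≈0 : ∀ {x y} → x · y ≈ 0# → x ≈ 0# ⊎ y ≈ 0#
  ·-≈0 {x} {y} xy≈0 with x ≟ 0#
  ... | yes x≈0 = inj₁ x≈0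
  ... | no x≉0 = inj₂ (·-cancelˡ x≉0 (trans xy≈0 (sym (zeroʳ _))))

  ^-≈0 : ∀ x n → x ^ n ≈ 0# → x ≈ 0#
  ^-≈0 x zero    1≈0 = contradiction 1≈0 1≉0
  ^-≈0 x (suc n) eq  = [ (λ x≈0 → x≈0) , ^-≈0 x n ]′ (·-≈0 eq)

  prod-≉0 : ∀ {n} (t : Vector Carrier n) → (∀ i → t i ≉ 0#) → Prod.sum t ≉ 0#
  prod-≉0 {zero}  t t≉0 = 1≉0
  prod-≉0 {suc n} t t≉0 = ·-≉0 (t≉0 zero) (prod-≉0 (tail t) (t≉0 ∘ suc))

  bijection⇒permutation : (f g : Carrier → Carrier) →
    (∀ {x y} → x ≈ y → f x ≈ f y) → (∀ {x y} → x ≈ y → g x ≈ g y) →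
    (∀ x → f (g x) ≈ x) → (∀ x → g (f x) ≈ x) → Permutation′ Q
  bijection⇒permutation f g f-cong g-cong fg gf =
    permutation (index ∘ f ∘ element) (index ∘ g ∘ element)
      (λ i → ≡.trans (index-cong (trans (f-cong (element-index _)) (fg _))) (index-element i))
      (λ i → ≡.trans (index-cong (trans (g-cong (element-index _)) (gf _))) (index-element i))

  -- Translation by 1 permutes the field. Summing all elements before and after it gives the same
  -- sum plus Q copies of 1.
  order×1≈0 : Q • 1# ≈ 0#
  order×1≈0 = ∙-cancelˡ (sum element) _ _ (begin
    sum element + Q • 1#                     ≈⟨ +-congˡ (sum-replicate Q) ⟨
    sum element + sum (replicate Q 1#)       ≈⟨ ∑-distrib-+ element (replicate Q 1#) ⟨
    sum (λ i → element i + 1#)               ≈⟨ sum-cong-≋ (λ i → element-index (element i + 1#)) ⟨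
    sum (λ i → element (translate ⟨$⟩ʳ i))   ≈⟨ sum-permute element translate ⟨
    sum element                              ≈⟨ +-identityʳ _ ⟨
    sum element + 0#                         ∎)
    where
    translate : Permutation′ Q
    translate = bijection⇒permutation (_+ 1#) (_+ - 1#) +-congʳ +-congʳ
      (λ x → trans (+-assoc _ _ _) (trans (+-congˡ (-‿inverseˡ 1#)) (+-identityʳ x)))
      (λ x → trans (+-assoc _ _ _) (trans (+-congˡ (-‿inverseʳ 1#)) (+-identityʳ x)))

  -- Multiplication by x permutes the nonzero elements, so their product `Π` equals `Π · x ^ n`, and
  -- the nonzero `Π` cancels.
  fermat : ∀ {n} → Q ≡ suc n → ∀ {x} → x ≉ 0# → x ^ n ≈ 1#
  fermat {n} Q≡1+n {x} x≉0 = ·-cancelˡ (prod-≉0 (unit ∘ element) (unit-≉0 ∘ element)) (begin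
    Π · x ^ n
      ≈⟨ *-congˡ (Prod.sum-replicate n) ⟨
    Π · Prod.sum (replicate n x)
      ≈⟨ *-congˡ (sum-almost-constant *-commutativeMonoid Q≡1+n (factor ∘ element) (index 0#) x
           (factor-0 (element-index 0#))
           (λ j j≢ → factor-≉0 (λ eⱼ≈0 →
             j≢ (≡.trans (≡.sym (index-element j)) (index-cong eⱼ≈0))))) ⟨
    Π · Prod.sum (factor ∘ element)
      ≈⟨ *-comm _ _ ⟩
    Prod.sum (factor ∘ element) · Π
      ≈⟨ Prod.∑-distrib-+ (factor ∘ element) (unit ∘ element) ⟨
    Prod.sum (λ i → factor (element i) · unit (element i))
      ≈⟨ Prod.sum-cong-≋ (λ i → trans (unit-cong (element-index _)) (unit-x· (element i))) ⟨
    Prod.sum (λ i → unit (element (scaling ⟨$⟩ʳ i)))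
      ≈⟨ Prod.sum-permute (unit ∘ element) scaling ⟨
    Π
      ≈⟨ *-identityʳ Π ⟨
    Π · 1# ∎)
    where
    x⁻¹ : Carrier
    x⁻¹ = proj₁ (inverse x x≉0)
    xx⁻¹≈1 : x · x⁻¹ ≈ 1#
    xx⁻¹≈1 = proj₂ (inverse x x≉0)
    -- Zero has to be left out of the product. `unit` lets it contribute 1, so that the product may
    -- run over all indices, and `factor` gives it no x, whence the exponent Q - 1.
    unit factor : Carrier → Carrier
    unit z with z ≟ 0#
    ... | yes _ = 1#
    ... | no  _ = z
    factor z with z ≟ 0#
    ... | yes _ = 1#
    ... | no  _ = x
    unit-≉0 : ∀ z → unit z ≉ 0#
    unit-≉0 z with z ≟ 0#
    ... | yes _   = 1≉0
    ... | no  z≉0 = z≉0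
    unit-cong : ∀ {y z} → y ≈ z → unit y ≈ unit z
    unit-cong {y} {z} y≈z with y ≟ 0# | z ≟ 0#
    ... | yes _   | yes _   = refl
    ... | yes y≈0 | no  z≉0 = contradiction (trans (sym y≈z) y≈0) z≉0
    ... | no  y≉0 | yes z≈0 = contradiction (trans y≈z z≈0) y≉0
    ... | no  _   | no  _   = y≈z
    factor-0 : ∀ {z} → z ≈ 0# → factor z ≈ 1#
    factor-0 {z} z≈0 with z ≟ 0#
    ... | yes _   = refl
    ... | no  z≉0 = contradiction z≈0 z≉0
    factor-≉0 : ∀ {z} → z ≉ 0# → factor z ≈ x
    factor-≉0 {z} z≉0 with z ≟ 0#
    ... | yes z≈0 = contradiction z≈0 z≉0
    ... | no  _   = refl
    unit-x· : ∀ z → unit (x · z) ≈ factor z · unit z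
    unit-x· z with z ≟ 0# | x · z ≟ 0#
    ... | yes _   | yes _    = sym (*-identityˡ 1#)
    ... | yes z≈0 | no  xz≉0 = contradiction (trans (*-congˡ z≈0) (zeroʳ x)) xz≉0
    ... | no  z≉0 | yes xz≈0 = contradiction xz≈0 (·-≉0 x≉0 z≉0)
    ... | no  _   | no  _    = refl
    Π : Carrier
    Π = Prod.sum (unit ∘ element)
    scaling : Permutation′ Q
    scaling = bijection⇒permutation (x ·_) (x⁻¹ ·_) *-congˡ *-congˡ
      (λ z → trans (sym (*-assoc _ _ _)) (trans (*-congʳ xx⁻¹≈1) (*-identityˡ z)))
      (λ z → trans (sym (*-assoc _ _ _))
        (trans (*-congʳ (trans (*-comm _ _) xx⁻¹≈1)) (*-identityˡ z)))

  module _ {p : ℕ} (p-prime : Prime p) (p×1≈0 : p • 1# ≈ 0#) where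

    p∣⇒×≈0 : ∀ {n} → p ∣ n → ∀ x → n • x ≈ 0#
    p∣⇒×≈0 {n} (divides d n≡d*p) x = begin
      n • x                  ≈⟨ ×-cong₂ n≡d*p (sym (*-identityˡ x)) ⟩
      (d ℕ.* p) • (1# · x)   ≈⟨ ×-assoc-* (d ℕ.* p) 1# x ⟨
      ((d ℕ.* p) • 1#) · x   ≈⟨ *-congʳ (×1-homo-* d p) ⟩
      (d • 1# · p • 1#) · x  ≈⟨ *-congʳ (trans (*-congˡ p×1≈0) (zeroʳ _)) ⟩
      0# · x                 ≈⟨ zeroˡ x ⟩
      0#                     ∎

    +-^p : ∀ x y → (x + y) ^ p ≈ x ^ p + y ^ p
    +-^p x y = go p ≡.refl
      where
      open Binomial commutativeSemiring using (theorem; binomialTerm)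
      -- The exponent becomes a variable so that it can be matched with a successor. This separates
      -- the two outer binomial terms from the inner ones, whose coefficients p divides.
      go : ∀ n → n ≡ p → (x + y) ^ n ≈ x ^ n + y ^ n
      go zero    ≡.refl = contradiction ≡.refl (ℕ.≢-nonZero⁻¹ 0 {{prime⇒nonZero p-prime}})
      go n@(suc n′) ≡.refl = begin
        (x + y) ^ n                                                   ≈⟨ theorem n x y ⟩
        term zero + sum (term ∘ suc)                                  ≈⟨ +-cong first (sum-init-last (term ∘ suc)) ⟩
        y ^ n + (sum (λ j → term (suc (inject₁ j))) + term (fromℕ n)) ≈⟨ +-congˡ (+-cong middle last) ⟩
        y ^ n + (0# + x ^ n)                                          ≈⟨ +-congˡ (+-identityˡ _) ⟩
        y ^ n + x ^ n                                                 ≈⟨ +-comm _ _ ⟩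
        x ^ n + y ^ n                                                 ∎
        where
        term : Fin (suc n) → Carrier
        term = binomialTerm x y n
        first : term zero ≈ y ^ n
        first = trans (×-congˡ {x = 1# · y ^ n} (≡.trans (nCk≡nC[n∸k] {0} {n} z≤n) (nCn≡1 n)))
                      (trans (×-homo-1 _) (*-identityˡ _))
        last : term (fromℕ n) ≈ x ^ n
        last rewrite Fin.toℕ-fromℕ n′ | nCn≡1 n | ℕ.n∸n≡0 n = trans (×-homo-1 _) (*-identityʳ _)
        middle : sum (λ j → term (suc (inject₁ j))) ≈ 0#
        middle = trans
          (sum-cong-≋ (λ j → p∣⇒×≈0 (prime∣binomial p-prime (s≤s z≤n)
            (s≤s (≡.subst (ℕ._< n′) (≡.sym (Fin.toℕ-inject₁ j)) (Fin.toℕ<n j)))) _))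
          (sum-replicate-zero n′)

    +-^p^ : ∀ e x y → (x + y) ^ (p ℕ.^ e) ≈ x ^ (p ℕ.^ e) + y ^ (p ℕ.^ e)
    +-^p^ zero x y = trans (*-identityʳ _) (sym (+-cong (*-identityʳ x) (*-identityʳ y)))
    +-^p^ (suc e) x y = begin
      (x + y) ^ (p ℕ.* p ℕ.^ e)                        ≈⟨ ^-assocʳ (x + y) p (p ℕ.^ e) ⟨
      ((x + y) ^ p) ^ (p ℕ.^ e)                        ≈⟨ ^-congˡ (p ℕ.^ e) (+-^p x y) ⟩
      (x ^ p + y ^ p) ^ (p ℕ.^ e)                      ≈⟨ +-^p^ e (x ^ p) (y ^ p) ⟩
      (x ^ p) ^ (p ℕ.^ e) + (y ^ p) ^ (p ℕ.^ e)        ≈⟨ +-cong (^-assocʳ x p _) (^-assocʳ y p _) ⟩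
      x ^ (p ℕ.* p ℕ.^ e) + y ^ (p ℕ.* p ℕ.^ e)        ∎

  -- The n-th power of `p • 1#` is `Q • 1#`, which vanishes, and a field has no nonzero nilpotent
  -- elements.
  characteristic : ∀ p n → Q ≡ p ℕ.^ n → p • 1# ≈ 0#
  characteristic p n Q≡p^n = ^-≈0 (p • 1#) n
    (trans (sym (×1-^ n)) (trans (×-congˡ {x = 1#} (≡.sym Q≡p^n)) order×1≈0))
    where
    ×1-^ : ∀ k → (p ℕ.^ k) • 1# ≈ (p • 1#) ^ k
    ×1-^ zero    = ×-homo-1 1#
    ×1-^ (suc k) = trans (×1-homo-* p (p ℕ.^ k)) (*-congˡ (×1-^ k))

-- Enumerating decidable subsets of a finite set

record Enumeration {n : ℕ} (P : Pred (Fin n) 0ℓ) : Set where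
  field
    size     : ℕ
    embed    : Fin size → Fin n
    -- Besides giving injectivity, order preservation ensures that earlier pivots in a list of
    -- vectors are earlier vectors of that list.
    monotone : ∀ {i j} → i Fin.< j → embed i Fin.< embed j
    sound    : ∀ i → P (embed i)
    complete : ∀ {j} → P j → ∃[ i ] embed i ≡ j

  embed-injective : ∀ {i j} → embed i ≡ embed j → i ≡ j
  embed-injective {i} {j} eq with Fin.<-cmp i j
  ... | tri< i<j _ _ = contradiction eq (Fin.<⇒≢ (monotone i<j))
  ... | tri≈ _ i≡j _ = i≡j
  ... | tri> _ _ j<i = contradiction (≡.sym eq) (Fin.<⇒≢ (monotone j<i))

enumerate : ∀ {n} {P : Pred (Fin n) 0ℓ} → Unary.Decidable P → Enumeration P
enumerate {zero} P? = record
  { size = 0 ; embed = λ () ; monotone = λ {} ; sound = λ () ; complete = λ { {()} } }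
enumerate {suc n} {P} P? with P? zero | enumerate (P? ∘ suc)
... | yes p | E = record
  { size     = suc size
  ; embed    = λ { zero → zero ; (suc i) → suc (embed i) }
  ; monotone = λ { {zero} {suc j} _ → s≤s z≤n ; {suc i} {suc j} (s≤s i<j) → s≤s (monotone i<j) }
  ; sound    = λ { zero → p ; (suc i) → sound i }
  ; complete = λ { {zero} _ → zero , ≡.refl
                 ; {suc j} pj → suc (proj₁ (complete pj)) , ≡.cong suc (proj₂ (complete pj)) }
  }
  where open Enumeration E
... | no ¬p | E = record
  { size     = size
  ; embed    = suc ∘ embed
  ; monotone = s≤s ∘ monotone
  ; sound    = sound
  ; complete = λ { {zero} p → contradiction p ¬p
                 ; {suc j} pj → proj₁ (complete pj) , ≡.cong suc (proj₂ (complete pj)) }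
  }
  where open Enumeration E

enumeration-cover : ∀ {n} {P : Pred (Fin n) 0ℓ} → Unary.Decidable P →
  (E : Enumeration P) (E′ : Enumeration (¬_ ∘ P)) →
  n ℕ.≤ Enumeration.size E ℕ.+ Enumeration.size E′
enumeration-cover {n} {P} P? E E′ = Fin.injective⇒≤ {f = join _ _ ∘ locate} (λ {i} {j} eq →
  ≡.trans (≡.sym (unlocate-locate i)) (≡.trans (≡.cong unlocate (join-injective (locate i) (locate j) eq))
  (unlocate-locate j)))
  where
  module E = Enumeration E
  module E′ = Enumeration E′
  locate : Fin n → Fin E.size ⊎ Fin E′.size
  locate i with P? i
  ... | yes p = inj₁ (proj₁ (E.complete p))
  ... | no ¬p = inj₂ (proj₁ (E′.complete ¬p))
  unlocate : Fin E.size ⊎ Fin E′.size → Fin n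
  unlocate = [ E.embed , E′.embed ]′
  unlocate-locate : ∀ i → unlocate (locate i) ≡ i
  unlocate-locate i with P? i
  ... | yes p = proj₂ (E.complete p)
  ... | no ¬p = proj₂ (E′.complete ¬p)
  join-injective : ∀ x y → join E.size E′.size x ≡ join E.size E′.size y → x ≡ y
  join-injective x y eq = ≡.trans (≡.sym (Fin.splitAt-join _ _ x))
    (≡.trans (≡.cong (splitAt E.size) eq) (Fin.splitAt-join _ _ y))

-- Subfields

record Subfield {Q : ℕ} (K : FiniteField Q) (s : ℕ) : Set₁ where
  open FiniteField K hiding (rawRing)
  field
    Member        : Pred Carrier 0ℓ
    0∈            : Member 0#
    1∈            : Member 1#
    +∈            : ∀ {x y} → Member x → Member y → Member (x + y)
    ·∈            : ∀ {x y} → Member x → Member y → Member (x · y)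
    -∈            : ∀ {x} → Member x → Member (- x)
    inverse∈      : ∀ {x y} → Member x → x · y ≈ 1# → Member y
    enum          : Fin s → Carrier
    enum∈         : ∀ i → Member (enum i)
    enum-injective : ∀ {i j} → enum i ≈ enum j → i ≡ j
    enum-complete : ∀ {x} → Member x → ∃[ i ] enum i ≈ x

  rawRing : RawRing 0ℓ 0ℓ
  rawRing = record
    { Carrier = Σ[ x ∈ Carrier ] Member x
    ; _≈_     = λ x y → proj₁ x ≈ proj₁ y
    ; _+_     = λ (x , x∈) (y , y∈) → x + y , +∈ x∈ y∈
    ; _*_     = λ (x , x∈) (y , y∈) → x · y , ·∈ x∈ y∈
    ; -_      = λ (x , x∈) → - x , -∈ x∈
    ; 0#      = 0# , 0∈
    ; 1#      = 1# , 1∈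
    }

  -- Equality of members is equality of first components, so the ring laws of the subfield can be
  -- pulled back along this map.
  inclusion : RingMorphisms.IsRingMonomorphism rawRing
                (CommutativeRing.rawRing commutativeRing) proj₁
  inclusion = record
    { isRingHomomorphism = record
      { isSemiringHomomorphism = record
        { isNearSemiringHomomorphism = record
          { +-isMonoidHomomorphism = record
            { isMagmaHomomorphism = record
              { isRelHomomorphism = record { cong = λ eq → eq }
              ; homo = λ _ _ → refl
              }
            ; ε-homo = refl
            }
          ; *-homo = λ _ _ → refl
          }
        ; 1#-homo = refl
        }
      ; -‿homo = λ _ → refl
      }
    ; injective = λ eq → eq
    }

  toField : FiniteField s
  toField = record
    { commutativeRing = record
      { isCommutativeRing = RingMonomorphism.isCommutativeRing inclusion isCommutativeRing }
    ; 1≉0 = 1≉0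
    ; inverse = λ (x , x∈) x≉0 → let (y , xy≈1) = inverse x x≉0 in (y , inverse∈ x∈ xy≈1) , xy≈1
    ; cardinality = record
      { to = λ i → enum i , enum∈ i
      ; cong = λ { ≡.refl → refl }
      ; bijective = enum-injective ,
          λ (x , x∈) → proj₁ (enum-complete x∈) , λ { ≡.refl → proj₂ (enum-complete x∈) }
      }
    }

-- With a field as its own subfield, linear algebra relative to a subfield specialises to the
-- ordinary one. It is used in this way over K and over F.
whole : ∀ {Q} (K : FiniteField Q) → Subfield K Q
whole K = record
  { Member = λ _ → ⊤ ; 0∈ = _ ; 1∈ = _ ; +∈ = _ ; ·∈ = _ ; -∈ = _ ; inverse∈ = _
  ; enum = element ; enum∈ = _ ; enum-injective = element-injective
  ; enum-complete = λ {x} _ → index x , element-index x }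
  where open FiniteFieldProperties K

-- With q = 2 + u, this is the divisibility of q^m - 1 by q - 1, stated without subtraction. The
-- quotient is n + 1, so n (q - 1) = q^m - q is the degree of the polynomial that is to vanish off
-- the fixed field.
^-≡-suc : ∀ u m .{{_ : NonZero m}} → ∃[ n ] (2 ℕ.+ u) ℕ.^ m ≡ suc (suc u ℕ.* suc n)
^-≡-suc u 1 = 0 , ≡.trans (ℕ.*-identityʳ _) (≡.cong suc (≡.sym (ℕ.*-identityʳ (suc u))))
^-≡-suc u (suc m@(suc _)) with ^-≡-suc u m
... | n , eq = (2 ℕ.+ u) ℕ.* suc n , ≡.trans (≡.cong ((2 ℕ.+ u) ℕ.*_) eq)
  (solve 2 (λ u n → (con 2 :+ u) :* (con 1 :+ (con 1 :+ u) :* (con 1 :+ n)) :=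
                    con 1 :+ (con 1 :+ u) :* (con 1 :+ (con 2 :+ u) :* (con 1 :+ n))) ≡.refl u n)
  where open ℕSolver.+-*-Solver

complement-≥ : ∀ u n {Q a b} → Q ≡ suc (suc u ℕ.* suc n) → Q ℕ.≤ a ℕ.+ b → b ℕ.≤ n ℕ.* suc u →
  2 ℕ.+ u ℕ.≤ a
complement-≥ u n {Q} {a} {b} Q≡ Q≤a+b b≤ = ℕ.+-cancelʳ-≤ (n ℕ.* suc u) (2 ℕ.+ u) a (begin
  2 ℕ.+ u ℕ.+ n ℕ.* suc u  ≡⟨ ≡.cong suc (ℕ.*-comm (suc n) (suc u)) ⟩
  suc (suc u ℕ.* suc n)    ≡⟨ Q≡ ⟨
  Q                        ≤⟨ Q≤a+b ⟩
  a ℕ.+ b                  ≤⟨ ℕ.+-monoʳ-≤ a b≤ ⟩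
  a ℕ.+ n ℕ.* suc u        ∎)
  where open ℕ.≤-Reasoning

-- Roots of monic polynomials and the subfield fixed by the q-th power map

module Polynomials {Q : ℕ} (K : FiniteField Q) where
  open FiniteField K hiding (_≉_; zero)
  open FiniteFieldProperties K
  open Exp commutativeSemiring
  open SemiringSolver commutativeSemiring using (solve; _:=_; _:+_; _:*_; con)
  open GroupProperties +-group using () renaming
    (x∙y⁻¹≈ε⇒x≈y to x-y≈0⇒x≈y; ∙-cancelˡ to +-cancelˡ; inverseʳ-unique to -‿unique)
  open import Relation.Binary.Reasoning.Setoid ≈-setoid

  -- cs lists the coefficients below the leading one, lowest degree first; the
  -- leading coefficient is 1.
  eval : ∀ {d} → Vec Carrier d → Carrier → Carrier
  eval []       x = 1#
  eval (c ∷ cs) x = c + x · eval cs x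

  -- Synthetic division by X - r: if f = c + X g, then f - f(r) = (X - r) g(r) + X (g - g(r)). The
  -- quotient is again monic, so its leading coefficient stays implicit.
  divide : ∀ {d} → Vec Carrier (suc d) → Carrier → Vec Carrier d
  divide {zero}  _        r = []
  divide {suc d} (c ∷ cs) r = eval cs r ∷ divide cs r

  y+[x-y]≈x : ∀ x y → y + (x + - y) ≈ x
  y+[x-y]≈x x y = trans (+-comm y _)
    (trans (+-assoc x _ y) (trans (+-congˡ (-‿inverseˡ y)) (+-identityʳ x)))

  divide-correct : ∀ {d} (f : Vec Carrier (suc d)) r x →
    eval f x ≈ eval f r + (x + - r) · eval (divide f r) x
  divide-correct {zero} (c ∷ []) r x = let z = x + - r in begin
    c + x · 1#               ≈⟨ +-congˡ (*-congʳ (y+[x-y]≈x x r)) ⟨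
    c + (r + z) · 1#         ≈⟨ solve 4 (λ c r z o →
                                  c :+ (r :+ z) :* o := (c :+ r :* o) :+ z :* o) refl c r z 1# ⟩
    c + r · 1# + z · 1#      ∎
  divide-correct {suc d} (c ∷ cs) r x =
    let z = x + - r ; g = eval cs r ; h = eval (divide cs r) x in begin
    c + x · eval cs x                  ≈⟨ +-congˡ (*-congˡ (divide-correct cs r x)) ⟩
    c + x · (g + z · h)                ≈⟨ +-congˡ (distribˡ x g (z · h)) ⟩
    c + (x · g + x · (z · h))          ≈⟨ +-congˡ (+-congʳ (*-congʳ (y+[x-y]≈x x r))) ⟨
    c + ((r + z) · g + x · (z · h))    ≈⟨ solve 6 (λ c r x z g h →
                                            c :+ ((r :+ z) :* g :+ x :* (z :* h)) :=
                                            (c :+ r :* g) :+ z :* (g :+ x :* h)) refl c r x z g h ⟩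
    c + r · g + z · (g + x · h)        ∎

  roots≤degree : ∀ {d} (f : Vec Carrier d) {n} (x : Fin n → Carrier) →
    (∀ {i j} → x i ≈ x j → i ≡ j) → (∀ i → eval f (x i) ≈ 0#) → n ℕ.≤ d
  roots≤degree f {zero} x inj root = z≤n
  roots≤degree [] {suc n} x inj root = contradiction (root zero) 1≉0
  roots≤degree f@(_ ∷ _) {suc n} x inj root = s≤s (roots≤degree (divide f (x zero)) (x ∘ suc)
    (Fin.suc-injective ∘ inj)
    (λ i → [ (λ eq → contradiction (inj (x-y≈0⇒x≈y _ _ eq)) λ ()) , (λ eq → eq) ]′
      (·-≈0 {x (suc i) + - x zero} (begin
        (x (suc i) + - x zero) · h i                   ≈⟨ +-identityˡ _ ⟨
        0# + (x (suc i) + - x zero) · h i              ≈⟨ +-congʳ (root zero) ⟨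
        eval f (x zero) + (x (suc i) + - x zero) · h i ≈⟨ divide-correct f (x zero) (x (suc i)) ⟨
        eval f (x (suc i))                             ≈⟨ root (suc i) ⟩
        0#                                             ∎))))
    where
    h : Fin n → Carrier
    h i = eval (divide f (x zero)) (x (suc i))

  eval-zeros : ∀ n {d} (cs : Vec Carrier d) x → eval (vreplicate n 0# ++ cs) x ≈ x ^ n · eval cs x
  eval-zeros zero    cs x = sym (*-identityˡ _)
  eval-zeros (suc n) cs x = trans (+-identityˡ _)
    (trans (*-congˡ (eval-zeros n cs x)) (sym (*-assoc _ _ _)))

  -- Here and below q = 2 + u.
  x^q-x : ∀ u → Vec Carrier (2 ℕ.+ u)
  x^q-x u = 0# ∷ - 1# ∷ vreplicate u 0#

  -- With y = x ^ (1 + u), geometric u n is 1 + y + ... + y ^ n.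
  geometric : ∀ u n → Vec Carrier (n ℕ.* suc u)
  geometric u zero    = []
  geometric u (suc n) = 1# ∷ (vreplicate u 0# ++ geometric u n)

  eval-geometric : ∀ u n x → let y = x ^ suc u in
    y ^ suc n ≈ 1# + (y + - 1#) · eval (geometric u n) x
  eval-geometric u zero x = let y = x ^ suc u in begin
    y · 1#                   ≈⟨ *-identityʳ y ⟩
    y                        ≈⟨ y+[x-y]≈x y 1# ⟨
    1# + (y + - 1#)          ≈⟨ +-congˡ (*-identityʳ _) ⟨
    1# + (y + - 1#) · 1#     ∎
  eval-geometric u (suc n) x =
    let y = x ^ suc u ; z = y + - 1# ; g = eval (geometric u n) x in begin
    y · y ^ suc n                  ≈⟨ *-congˡ (eval-geometric u n x) ⟩
    y · (1# + z · g)               ≈⟨ distribˡ y _ _ ⟩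
    y · 1# + y · (z · g)           ≈⟨ +-congʳ (trans (*-identityʳ y) (sym (y+[x-y]≈x y 1#))) ⟩
    1# + z + y · (z · g)           ≈⟨ solve 3 (λ z y g → con 1 :+ z :+ y :* (z :* g) :=
                                                         con 1 :+ z :* (con 1 :+ y :* g)) refl z y g ⟩
    1# + z · (1# + y · g)          ≈⟨ +-congˡ (*-congˡ (+-congˡ (trans
                                        (*-congˡ (eval-zeros u (geometric u n) x))
                                        (sym (*-assoc _ _ _))))) ⟨
    1# + z · eval (geometric u (suc n)) x ∎

  x^q≈x⇒root : ∀ u {x} → x ^ (2 ℕ.+ u) ≈ x → eval (x^q-x u) x ≈ 0#
  x^q≈x⇒root u {x} eq = begin
    0# + x · (- 1# + x · eval (vreplicate u 0#) x) ≈⟨ +-identityˡ _ ⟩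
    x · (- 1# + x · eval (vreplicate u 0#) x)      ≈⟨ *-congˡ (+-congˡ (*-congˡ (zeros u))) ⟩
    x · (- 1# + x · x ^ u)                         ≈⟨ distribˡ x _ _ ⟩
    x · - 1# + x · (x · x ^ u)                     ≈⟨ +-congˡ (trans eq (sym (*-identityʳ x))) ⟩
    x · - 1# + x · 1#                              ≈⟨ distribˡ x _ _ ⟨
    x · (- 1# + 1#)                                ≈⟨ *-congˡ (-‿inverseˡ 1#) ⟩
    x · 0#                                         ≈⟨ zeroʳ x ⟩
    0#                                             ∎
    where
    zeros : ∀ u → eval (vreplicate u 0#) x ≈ x ^ u
    zeros zero    = refl
    zeros (suc u) = trans (+-identityˡ _) (*-congˡ (zeros u))

  module _ {p e : ℕ} (p-prime : Prime p) (m : ℕ) .{{_ : NonZero m}} (u : ℕ)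
           (q≡ : 2 ℕ.+ u ≡ p ℕ.^ e) (Q≡q^m : Q ≡ (2 ℕ.+ u) ℕ.^ m) where

    private
      q : ℕ
      q = 2 ℕ.+ u

      Fixed : Pred Carrier 0ℓ
      Fixed x = x ^ q ≈ x

      n : ℕ
      n = proj₁ (^-≡-suc u m)

      Q≡ : Q ≡ suc (suc u ℕ.* suc n)
      Q≡ = ≡.trans Q≡q^m (proj₂ (^-≡-suc u m))

      -- For nonzero x and y = x ^ (q - 1), `fermat` gives y ^ (n + 1) ≈ 1, so y - 1 times the
      -- geometric sum is zero. If the first factor vanishes, then x ^ q ≈ x.
      fixed∨root : ∀ x → Fixed x ⊎ eval (geometric u n) x ≈ 0#
      fixed∨root x with x ≟ 0#
      ... | yes x≈0 = inj₁ (trans (*-congʳ x≈0) (trans (zeroˡ _) (sym x≈0)))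
      ... | no  x≉0 = [ (λ y-1≈0 → inj₁ (trans (*-congˡ (x-y≈0⇒x≈y _ _ y-1≈0)) (*-identityʳ x))) , inj₂ ]′
        (·-≈0 (+-cancelˡ 1# _ _ (begin
          1# + (x ^ suc u + - 1#) · eval (geometric u n) x ≈⟨ eval-geometric u n x ⟨
          (x ^ suc u) ^ suc n                              ≈⟨ ^-assocʳ x (suc u) (suc n) ⟩
          x ^ (suc u ℕ.* suc n)                            ≈⟨ fermat Q≡ x≉0 ⟩
          1#                                               ≈⟨ +-identityʳ 1# ⟨
          1# + 0#                                          ∎)))

      fixed? : Unary.Decidable (Fixed ∘ element)
      fixed? i = element i ^ q ≟ element i

      fixed : Enumeration (Fixed ∘ element)
      fixed = enumerate fixed?

      unfixed : Enumeration (λ i → ¬ Fixed (element i))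
      unfixed = enumerate (¬? ∘ fixed?)

      module F = Enumeration fixed
      module U = Enumeration unfixed

      fixed-count : F.size ≡ q
      fixed-count = ℕ.≤-antisym
        (roots≤degree (x^q-x u) (element ∘ F.embed) (F.embed-injective ∘ element-injective)
          (x^q≈x⇒root u ∘ F.sound))
        (complement-≥ u n Q≡ (enumeration-cover fixed? fixed unfixed) U≤)
        where
        U≤ : U.size ℕ.≤ n ℕ.* suc u
        U≤ = roots≤degree (geometric u n) (element ∘ U.embed) (U.embed-injective ∘ element-injective)
          (λ i → [ (λ fix → contradiction fix (U.sound i)) , (λ eq → eq) ]′
            (fixed∨root (element (U.embed i))))

      frobenius-+ : ∀ x y → (x + y) ^ q ≈ x ^ q + y ^ q
      frobenius-+ x y = ≡.subst (λ r → (x + y) ^ r ≈ x ^ r + y ^ r) (≡.sym q≡)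
        (+-^p^ p-prime
          (characteristic p (e ℕ.* m)
            (≡.trans Q≡q^m (≡.trans (≡.cong (ℕ._^ m) q≡) (ℕ.^-*-assoc p e m))))
          e x y)

      cast : Fin q → Fin F.size
      cast = Fin.cast (≡.sym fixed-count)

    fixedField : Subfield K q
    fixedField = record
      { Member = Fixed
      ; 0∈ = zeroˡ _
      ; 1∈ = 1^ q
      ; +∈ = λ {x} {y} x∈ y∈ → trans (frobenius-+ x y) (+-cong x∈ y∈)
      ; ·∈ = λ {x} {y} x∈ y∈ → trans (^-distrib-* x y q) (*-cong x∈ y∈)
      -- Additivity of the q-th power makes `(- x) ^ q` an additive inverse of `x ^ q ≈ x`, which
      -- avoids a case distinction on the parity of q.
      ; -∈ = λ {x} x∈ → -‿unique x ((- x) ^ q) (begin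
          x + (- x) ^ q      ≈⟨ +-congʳ x∈ ⟨
          x ^ q + (- x) ^ q  ≈⟨ frobenius-+ x (- x) ⟨
          (x + - x) ^ q      ≈⟨ ^-congˡ q (-‿inverseʳ x) ⟩
          0# ^ q             ≈⟨ zeroˡ _ ⟩
          0#                 ∎)
      ; inverse∈ = λ {x} {y} x∈ xy≈1 →
          ·-cancelˡ {x} (λ x≈0 → 1≉0 (trans (sym xy≈1) (trans (*-congʳ x≈0) (zeroˡ y)))) (begin
            x · y ^ q      ≈⟨ *-congʳ x∈ ⟨
            x ^ q · y ^ q  ≈⟨ ^-distrib-* x y q ⟨
            (x · y) ^ q    ≈⟨ ^-congˡ q xy≈1 ⟩
            1# ^ q         ≈⟨ 1^ q ⟩
            1#             ≈⟨ xy≈1 ⟨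
            x · y          ∎)
      ; enum = element ∘ F.embed ∘ cast
      ; enum∈ = F.sound ∘ cast
      ; enum-injective = λ eq → Fin.toℕ-injective (≡.trans (≡.sym (Fin.toℕ-cast _ _))
          (≡.trans (≡.cong toℕ (F.embed-injective (element-injective eq))) (Fin.toℕ-cast _ _)))
      ; enum-complete = λ {x} x∈ →
          let (i , eq) = F.complete (trans (^-congˡ q (element-index x)) (trans x∈ (sym (element-index x))))
          in Fin.cast fixed-count i ,
             trans (reflexive (≡.cong element
                     (≡.trans (≡.cong F.embed (Fin.cast-involutive _ fixed-count i)) eq)))
                   (element-index x)
      }
      where
      1^ : ∀ k → 1# ^ k ≈ 1#
      1^ zero    = refl
      1^ (suc k) = trans (*-identityˡ _) (1^ k)

funToFin-cong : ∀ {m n} {f g : Fin m → Fin n} → (∀ i → f i ≡ g i) → funToFin f ≡ funToFin g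
funToFin-cong {zero}  f≗g = ≡.refl
funToFin-cong {suc m} f≗g = ≡.cong₂ combine (f≗g zero) (funToFin-cong (f≗g ∘ suc))

finToFun-injective : ∀ {m n} {t t′ : Fin (m ℕ.^ n)} → (∀ i → finToFun {m} {n} t i ≡ finToFun t′ i) → t ≡ t′
finToFun-injective {m} {n} {t} {t′} eq = ≡.trans (≡.sym (Fin.funToFin-finToFin {n} t))
  (≡.trans (funToFin-cong eq) (Fin.funToFin-finToFin {n} t′))

^-cancelʳ-≤ : ∀ s {k r} → 1 ℕ.< s → s ℕ.^ k ℕ.≤ s ℕ.^ r → k ℕ.≤ r
^-cancelʳ-≤ s 1<s s^k≤s^r = ℕ.≮⇒≥ (λ r<k → ℕ.<⇒≱ (ℕ.^-monoʳ-< s 1<s r<k) s^k≤s^r)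

inject-< : ∀ {n} {j : Fin n} (i : Fin.Fin′ j) → inject i Fin.< j
inject-< {j = j} i = ≡.subst (ℕ._< toℕ j) (≡.sym (Fin.toℕ-inject i)) (Fin.toℕ<n i)

-- Linear algebra

module LinearCombinations {Q : ℕ} (K : FiniteField Q) where
  open FiniteField K hiding (_≉_; zero)
  open LinearAlgebra K
  open SemiringSum semiring
  open import Relation.Binary.Reasoning.Setoid ≈-setoid

  -- Isolates the last nonzero term of a linear relation, so that it can be solved for the
  -- corresponding vector.
  sum-split : ∀ {n} (j : Fin n) (t : Vector Carrier n) → (∀ i → j Fin.< i → t i ≈ 0#) →
    sum t ≈ sum (t ∘ inject {i = j}) + t j
  sum-split {suc n} zero t t>≈0 = begin
    t zero + sum (t ∘ suc)      ≈⟨ +-congˡ (sum-cong-≋ (λ i → t>≈0 (suc i) (s≤s z≤n))) ⟩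
    t zero + sum {n} (λ _ → 0#) ≈⟨ +-congˡ (sum-replicate-zero n) ⟩
    t zero + 0#                 ≈⟨ +-comm _ _ ⟩
    0# + t zero                 ∎
  sum-split {suc n} (suc j) t t>≈0 = trans
    (+-congˡ (sum-split j (t ∘ suc) (λ i j<i → t>≈0 (suc i) (s≤s j<i))))
    (sym (+-assoc _ _ _))

  module _ {I : Set} where

    lincomb-cong : ∀ {k} {c d : Vector Carrier k} {v w : Vector (I → Carrier) k} →
      (∀ i → c i ≈ d i) → (∀ i → v i ≋ w i) → lincomb c v ≋ lincomb d w
    lincomb-cong c≈d v≋w x = sum-cong-≋ (λ i → *-cong (c≈d i) (v≋w i x))

    lincomb-+ : ∀ {k} (c d : Vector Carrier k) (v : Vector (I → Carrier) k) x →
      lincomb (λ i → c i + d i) v x ≈ lincomb c v x + lincomb d v x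
    lincomb-+ c d v x = trans
      (sum-cong-≋ (λ i → distribʳ (v i x) (c i) (d i)))
      (∑-distrib-+ (λ i → c i · v i x) (λ i → d i · v i x))

    lincomb-· : ∀ {k} e (c : Vector Carrier k) (v : Vector (I → Carrier) k) x →
      lincomb (λ i → e · c i) v x ≈ e · lincomb c v x
    lincomb-· e c v x = trans
      (sum-cong-≋ (λ i → *-assoc e (c i) (v i x)))
      (sym (*-distribˡ-sum e (λ i → c i · v i x)))

    lincomb-0 : ∀ {k} {c : Vector Carrier k} (v : Vector (I → Carrier) k) →
      (∀ i → c i ≈ 0#) → lincomb c v ≋ 𝟎
    lincomb-0 {k} v c≈0 x = trans
      (sum-cong-≋ (λ i → trans (*-congʳ (c≈0 i)) (zeroˡ _)))
      (sum-replicate-zero k)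

    lincomb-- : ∀ {k} (c d : Vector Carrier k) (v : Vector (I → Carrier) k) →
      lincomb c v ≋ lincomb d v → lincomb (λ i → c i + - d i) v ≋ 𝟎
    lincomb-- c d v eq x = begin
      lincomb (λ i → c i + - d i) v x                     ≈⟨ lincomb-+ c (-_ ∘ d) v x ⟩
      lincomb c v x + lincomb (-_ ∘ d) v x                ≈⟨ +-congʳ (eq x) ⟩
      lincomb d v x + lincomb (-_ ∘ d) v x                ≈⟨ lincomb-+ d (-_ ∘ d) v x ⟨
      lincomb (λ i → d i + - d i) v x                     ≈⟨ lincomb-0 v (λ i → -‿inverseʳ (d i)) x ⟩
      0#                                                  ∎

-- Vectors have entries in K; only the scalars are restricted to S.
module RelativeLinearAlgebra {Q s : ℕ} (K : FiniteField Q) (S : Subfield K s) where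
  open FiniteField K hiding (_≉_; zero)
  open FiniteFieldProperties K
  open Subfield S
  open LinearAlgebra K
  open LinearCombinations K
  open SemiringSum semiring
  open GroupProperties +-group using () renaming
    (x∙y⁻¹≈ε⇒x≈y to x-y≈0⇒x≈y; inverseʳ-unique to -‿unique)
  open RingProperties ring using (-‿distribˡ-*)
  open import Relation.Binary.Reasoning.Setoid ≈-setoid

  -- 0 and 1 are distinct members. A base above 1 lets exponents, here dimensions, be compared
  -- through their powers.
  1<order : 1 ℕ.< s
  1<order with enum-complete 0∈ | enum-complete 1∈
  ... | i , eᵢ≈0 | j , eⱼ≈1 = distinct⇒1< s i j (λ i≡j → 1≉0
          (trans (sym eⱼ≈1) (trans (reflexive (≡.cong enum (≡.sym i≡j))) eᵢ≈0)))
    where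
    distinct⇒1< : ∀ n (i j : Fin n) → i ≢ j → 1 ℕ.< n
    distinct⇒1< 1 zero zero i≢j = contradiction ≡.refl i≢j
    distinct⇒1< (suc (suc n)) i j i≢j = s≤s (s≤s z≤n)

  module _ {I : Set} where

    SpanOver : ∀ {k} → Vector (I → Carrier) k → (I → Carrier) → Set
    SpanOver v w = ∃[ c ] ((∀ i → Member (c i)) × w ≋ lincomb c v)

    IndependentOver : ∀ {k} → Vector (I → Carrier) k → Set
    IndependentOver v = ∀ c → (∀ i → Member (c i)) → lincomb c v ≋ 𝟎 → ∀ i → c i ≈ 0#

    span-resp : ∀ {k} {v : Vector (I → Carrier) k} {u w} → u ≋ w → SpanOver v u → SpanOver v w
    span-resp u≋w (c , c∈ , u≋) = c , c∈ , λ x → trans (sym (u≋w x)) (u≋ x)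

    span-𝟎 : ∀ {k} {v : Vector (I → Carrier) k} → SpanOver v 𝟎
    span-𝟎 {v = v} = (λ _ → 0#) , (λ _ → 0∈) , λ x → sym (lincomb-0 v (λ _ → refl) x)

    span-+ : ∀ {k} {v : Vector (I → Carrier) k} {u w} →
      SpanOver v u → SpanOver v w → SpanOver v (λ x → u x + w x)
    span-+ {v = v} (c , c∈ , u≋) (d , d∈ , w≋) = (λ i → c i + d i) , (λ i → +∈ (c∈ i) (d∈ i)) ,
      λ x → trans (+-cong (u≋ x) (w≋ x)) (sym (lincomb-+ c d v x))

    span-· : ∀ {k} {v : Vector (I → Carrier) k} {u e} →
      Member e → SpanOver v u → SpanOver v (λ x → e · u x)
    span-· {v = v} {e = e} e∈ (c , c∈ , u≋) = (λ i → e · c i) , (λ i → ·∈ e∈ (c∈ i)) ,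
      λ x → trans (*-congˡ (u≋ x)) (sym (lincomb-· e c v x))

    span-lincomb : ∀ {k r} {v : Vector (I → Carrier) k} {w : Vector (I → Carrier) r} {c} →
      (∀ i → Member (c i)) → (∀ i → SpanOver w (v i)) → SpanOver w (lincomb c v)
    span-lincomb {zero}  c∈ v∈ = span-𝟎
    span-lincomb {suc k} c∈ v∈ = span-+ (span-· (c∈ zero) (v∈ zero)) (span-lincomb (c∈ ∘ suc) (v∈ ∘ suc))

    span-trans : ∀ {k r} {v : Vector (I → Carrier) k} {w : Vector (I → Carrier) r} {u} →
      (∀ i → SpanOver w (v i)) → SpanOver v u → SpanOver w u
    span-trans v∈ (c , c∈ , u≋) = span-resp (λ x → sym (u≋ x)) (span-lincomb c∈ v∈)

    span-weaken : ∀ {k} (v : Vector (I → Carrier) (suc k)) {u} → SpanOver (v ∘ suc) u → SpanOver v u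
    span-weaken v {u} (c , c∈ , u≋) = c⁺ , c⁺∈ , λ x → begin
      u x                                    ≈⟨ u≋ x ⟩
      lincomb c (v ∘ suc) x                  ≈⟨ +-identityˡ _ ⟨
      0# + lincomb c (v ∘ suc) x             ≈⟨ +-congʳ (zeroˡ _) ⟨
      0# · v zero x + lincomb c (v ∘ suc) x  ∎
      where
      c⁺ : Vector Carrier _
      c⁺ zero    = 0#
      c⁺ (suc i) = c i
      c⁺∈ : ∀ i → Member (c⁺ i)
      c⁺∈ zero    = 0∈
      c⁺∈ (suc i) = c∈ i

    span-∋ : ∀ {k} (v : Vector (I → Carrier) k) j → SpanOver v (v j)
    span-∋ v zero = δ , δ∈ , λ x → begin
      v zero x                                        ≈⟨ *-identityˡ _ ⟨
      1# · v zero x                                   ≈⟨ +-identityʳ _ ⟨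
      1# · v zero x + 0#                              ≈⟨ +-congˡ (lincomb-0 (v ∘ suc) (λ _ → refl) x) ⟨
      1# · v zero x + lincomb (λ _ → 0#) (v ∘ suc) x  ∎
      where
      δ : Vector Carrier _
      δ zero    = 1#
      δ (suc _) = 0#
      δ∈ : ∀ i → Member (δ i)
      δ∈ zero    = 1∈
      δ∈ (suc _) = 0∈
    span-∋ v (suc j) = span-weaken v (span-∋ (v ∘ suc) j)

    -- The largest index with a nonzero coefficient would be in the span of its predecessors.
    ∉-predecessors⇒independent : ∀ {n} (v : Vector (I → Carrier) n) →
      (∀ j → ¬ SpanOver (v ∘ inject {i = j}) (v j)) → IndependentOver v
    ∉-predecessors⇒independent {n} v v∉ c c∈ Σ≋0 j = go j (>-wellFounded j)
      where
      go : ∀ j → Acc Fin._>_ j → c j ≈ 0#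
      go j (acc rec) with c j ≟ 0#
      ... | yes cⱼ≈0 = cⱼ≈0
      ... | no  cⱼ≉0 = contradiction
              ((λ i → - y · c (inject i)) , (λ i → ·∈ (-∈ (inverse∈ (c∈ j) cⱼy≈1)) (c∈ (inject i))) , vⱼ≋)
              (v∉ j)
        where
        y : Carrier
        y = proj₁ (inverse (c j) cⱼ≉0)
        cⱼy≈1 : c j · y ≈ 1#
        cⱼy≈1 = proj₂ (inverse (c j) cⱼ≉0)
        c⁻ : Fin.Fin′ j → Carrier
        c⁻ i = c (inject i)
        v⁻ : Fin.Fin′ j → I → Carrier
        v⁻ i = v (inject i)
        vⱼ≋ : v j ≋ lincomb (λ i → - y · c⁻ i) v⁻
        vⱼ≋ x = begin
          v j x                             ≈⟨ *-identityˡ _ ⟨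
          1# · v j x                        ≈⟨ *-congʳ (trans (*-comm y _) cⱼy≈1) ⟨
          y · c j · v j x                   ≈⟨ *-assoc _ _ _ ⟩
          y · (c j · v j x)                 ≈⟨ -‿unique (y · lincomb c⁻ v⁻ x) _ (begin
            y · lincomb c⁻ v⁻ x + y · (c j · v j x)
              ≈⟨ distribˡ y _ _ ⟨
            y · (lincomb c⁻ v⁻ x + c j · v j x)
              ≈⟨ *-congˡ (sum-split j (λ i → c i · v i x)
                   (λ i j<i → trans (*-congʳ (go i (rec j<i))) (zeroˡ _))) ⟨
            y · lincomb c v x
              ≈⟨ *-congˡ (Σ≋0 x) ⟩
            y · 0#
              ≈⟨ zeroʳ y ⟩
            0# ∎) ⟩
          - (y · lincomb c⁻ v⁻ x)           ≈⟨ -‿distribˡ-* y _ ⟩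
          - y · lincomb c⁻ v⁻ x             ≈⟨ lincomb-· (- y) c⁻ v⁻ x ⟨
          lincomb (λ i → - y · c⁻ i) v⁻ x   ∎

    -- The base-s digits of t index the coefficients, so t runs through all combinations of `v` over
    -- the subfield.
    decode : ∀ {k} → Vector (I → Carrier) k → Fin (s ℕ.^ k) → I → Carrier
    decode v t = lincomb (enum ∘ finToFun t) v

    decode-injective : ∀ {k} (v : Vector (I → Carrier) k) → IndependentOver v →
      ∀ {t t′} → decode v t ≋ decode v t′ → t ≡ t′
    decode-injective {k} v indep {t} {t′} eq = finToFun-injective {s} {k} (λ i → enum-injective
      (x-y≈0⇒x≈y _ _ (indep _ (λ i → +∈ (enum∈ _) (-∈ (enum∈ _)))
        (lincomb-- (enum ∘ finToFun t) (enum ∘ finToFun t′) v eq) i)))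

    encode : ∀ {k} {v : Vector (I → Carrier) k} {u} → SpanOver v u → Fin (s ℕ.^ k)
    encode (c , c∈ , _) = funToFin (λ i → proj₁ (enum-complete (c∈ i)))

    decode-encode : ∀ {k} (v : Vector (I → Carrier) k) {u} (u∈ : SpanOver v u) → decode v (encode u∈) ≋ u
    decode-encode v {u} (c , c∈ , u≋) x = begin
      decode v (encode (c , c∈ , u≋)) x ≈⟨ lincomb-cong {v = v} (λ i → trans
                                             (reflexive (≡.cong enum (Fin.finToFun-funToFin _ i)))
                                             (proj₂ (enum-complete (c∈ i)))) (λ _ _ → refl) x ⟩
      lincomb c v x                     ≈⟨ u≋ x ⟨
      u x                               ∎

    -- Counting takes the place of the exchange lemma: the s ^ k combinations of `v` are distinct,
    -- and each occurs among the s ^ r combinations of `w`.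
    independent∧spanned⇒≤ : ∀ {k r} {v : Vector (I → Carrier) k} {w : Vector (I → Carrier) r} →
      IndependentOver v → (∀ i → SpanOver w (v i)) → k ℕ.≤ r
    independent∧spanned⇒≤ {k} {r} {v} {w} indep v∈ = ^-cancelʳ-≤ s 1<order
      (Fin.injective⇒≤ {f = encode ∘ decode∈} (λ {t} {t′} eq → decode-injective v indep (λ x → begin
        decode v t x                     ≈⟨ decode-encode w (decode∈ t) x ⟨
        decode w (encode (decode∈ t)) x  ≈⟨ reflexive (≡.cong (λ t → decode w t x) eq) ⟩
        decode w (encode (decode∈ t′)) x ≈⟨ decode-encode w (decode∈ t′) x ⟩
        decode v t′ x                    ∎)))
      where
      decode∈ : ∀ t → SpanOver w (decode v t)
      decode∈ t = span-lincomb (λ i → enum∈ (finToFun {s} {k} t i)) v∈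

    module _ (_≋?_ : (u w : I → Carrier) → Dec (u ≋ w)) where

      -- There are finitely many coefficient vectors to try. Equality of vectors is a parameter
      -- because its decidability depends on `I`.
      span? : ∀ {k} (v : Vector (I → Carrier) k) w → Dec (SpanOver v w)
      span? v w = Dec.map′
        (λ (t , w≋) → enum ∘ finToFun t , (λ _ → enum∈ _) , w≋)
        (λ w∈ → encode w∈ , λ x → sym (decode-encode v w∈ x))
        (Fin.any? (λ t → w ≋? decode v t))

      module Pivots {n} (v : Vector (I → Carrier) n) where

        dependent? : ∀ j → Dec (SpanOver (v ∘ inject {i = j}) (v j))
        dependent? j = span? (v ∘ inject) (v j)

        pivots : Enumeration (λ j → ¬ SpanOver (v ∘ inject {i = j}) (v j))
        pivots = enumerate (¬? ∘ dependent?)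

        open Enumeration pivots public

        -- Earlier pivots are among the predecessors of a pivot in `v`, so a pivot spanned by
        -- earlier pivots would be spanned by its predecessors.
        pivots-independent : IndependentOver (v ∘ embed)
        pivots-independent = ∉-predecessors⇒independent (v ∘ embed) (λ j v∈ →
          sound j (span-trans (predecessor∈ j) v∈))
          where
          predecessor∈ : ∀ j i → SpanOver (v ∘ inject {i = embed j}) (v (embed (inject {i = j} i)))
          predecessor∈ j i = ≡.subst (λ l → SpanOver (v ∘ inject {i = embed j}) (v l))
            (Fin.toℕ-injective (≡.trans (Fin.toℕ-inject {i = embed j} _) (Fin.toℕ-fromℕ< lt)))
            (span-∋ (v ∘ inject) (fromℕ< lt))
            where
            lt : embed (inject {i = j} i) Fin.< embed j
            lt = monotone (inject-< i)

        -- By induction on j: a vector that is no pivot is a combination of predecessors, which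
        -- already lie in the span of the pivots.
        pivots-spanning : ∀ j → SpanOver (v ∘ embed) (v j)
        pivots-spanning j = go j (<-wellFounded j)
          where
          go : ∀ j → Acc Fin._<_ j → SpanOver (v ∘ embed) (v j)
          go j (acc rec) with dependent? j
          ... | yes v∈ = span-trans (λ i → go (inject i) (rec (inject-< i))) v∈
          ... | no v∉ = let (i , eq) = complete v∉ in
            ≡.subst (λ l → SpanOver (v ∘ embed) (v l)) eq (span-∋ (v ∘ embed) i)

  -- Elements of K are vectors with a single entry, hence `I = ⊤`. The pivots of the list of all
  -- elements form a basis. Its combinations inject into K and K injects into them, so its size is
  -- m.
  relativeBasis : ∀ {m} → Q ≡ s ℕ.^ m → ∃[ β ] (IndependentOver {I = ⊤} {m} β × (∀ u → SpanOver β u))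
  relativeBasis {m} Q≡s^m = ≡.subst
    (λ d → ∃[ β ] (IndependentOver {I = ⊤} {d} β × (∀ u → SpanOver β u)))
    (ℕ.≤-antisym
      (^-cancelʳ-≤ s 1<order (≡.subst (s ℕ.^ P.size ℕ.≤_) Q≡s^m
        (Fin.injective⇒≤ {f = λ t → index (decode b t tt)}
          (λ eq → decode-injective b P.pivots-independent (λ _ → index-injective eq)))))
      (^-cancelʳ-≤ s 1<order (≡.subst (ℕ._≤ s ℕ.^ P.size) Q≡s^m
        (Fin.injective⇒≤ {f = encode ∘ P.pivots-spanning} (λ {i} {j} eq → element-injective (begin
          element i
            ≈⟨ decode-encode b (P.pivots-spanning i) tt ⟨
          decode b (encode (P.pivots-spanning i)) tt
            ≈⟨ reflexive (≡.cong (λ t → decode b t tt) eq) ⟩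
          decode b (encode (P.pivots-spanning j)) tt
            ≈⟨ decode-encode b (P.pivots-spanning j) tt ⟩
          element j ∎))))))
    (b , P.pivots-independent ,
      λ u → span-resp (λ _ → element-index (u tt)) (P.pivots-spanning (index (u tt))))
    where
    v : Vector (⊤ → Carrier) Q
    v i _ = element i
    module P = Pivots (λ u w → Dec.map′ (λ eq _ → eq) (λ eq → eq tt) (u tt ≟ w tt)) v
    b : Vector (⊤ → Carrier) P.size
    b = v ∘ P.embed


module _ {Q : ℕ} (K : FiniteField Q) where
  open FiniteField K using (Carrier)
  open FiniteFieldProperties K using (_≟_)
  open LinearAlgebra K
  open RelativeLinearAlgebra K (whole K)

  module _ {I : Set} {k : ℕ} (v : Vector (I → Carrier) k) {w : I → Carrier} where

    spanOver-whole⇒span : SpanOver v w → w ∈ Span v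
    spanOver-whole⇒span (c , _ , w≋) = c , w≋

    span⇒spanOver-whole : w ∈ Span v → SpanOver v w
    span⇒spanOver-whole (c , w≋) = c , _ , w≋

  -- Rank is a relation, so the minimality of δ says something about a codeword only once a rank of
  -- it is exhibited.
  rank-exists : ∀ {a n} (M : Matrix a n) → ∃[ r ] HasRank M r
  rank-exists M = P.size , record
    { basis       = columns M ∘ P.embed
    ; basis∈      = λ i → spanOver-whole⇒span (columns M) (span-∋ (columns M) (P.embed i))
    ; independent = λ c → P.pivots-independent c _
    ; spanning    = λ w∈ → spanOver-whole⇒span (columns M ∘ P.embed)
        (span-trans P.pivots-spanning (span⇒spanOver-whole (columns M) w∈))
    }
    where
    module P = Pivots (λ u w → Fin.all? (λ i → u i ≟ w i)) (columns M)

-- Linear maps and triangular column operations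

module LinearMaps {Q : ℕ} (K : FiniteField Q) where
  open FiniteField K hiding (_≉_; zero)
  open LinearAlgebra K
  open LinearCombinations K
  open SemiringSum semiring
  open import Relation.Binary.Reasoning.Setoid ≈-setoid

  record IsLinear {I J : Set} (f : (I → Carrier) → (J → Carrier)) : Set where
    field
      f-cong : ∀ {u v} → u ≋ v → f u ≋ f v
      f-+    : ∀ u v → f (λ x → u x + v x) ≋ (λ x → f u x + f v x)
      f-·    : ∀ c v → f (λ x → c · v x) ≋ (λ x → c · f v x)

    f-𝟎 : f 𝟎 ≋ 𝟎
    f-𝟎 x = begin
      f 𝟎 x              ≈⟨ f-cong (λ _ → zeroˡ 0#) x ⟨
      f (λ _ → 0# · 0#) x ≈⟨ f-· 0# 𝟎 x ⟩
      0# · f 𝟎 x         ≈⟨ zeroˡ _ ⟩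
      0#                 ∎

    f-lincomb : ∀ {k} (c : Vector Carrier k) (v : Vector (I → Carrier) k) →
      f (lincomb c v) ≋ lincomb c (f ∘ v)
    f-lincomb {zero}  c v = f-𝟎
    f-lincomb {suc k} c v x = begin
      f (λ y → c zero · v zero y + lincomb (c ∘ suc) (v ∘ suc) y) x
        ≈⟨ f-+ (λ y → c zero · v zero y) (lincomb (c ∘ suc) (v ∘ suc)) x ⟩
      f (λ y → c zero · v zero y) x + f (lincomb (c ∘ suc) (v ∘ suc)) x
        ≈⟨ +-cong (f-· (c zero) (v zero) x) (f-lincomb (c ∘ suc) (v ∘ suc) x) ⟩
      c zero · f (v zero) x + lincomb (c ∘ suc) (f ∘ v ∘ suc) x ∎

  sum-+ : ∀ m {n} (t : Vector Carrier (m ℕ.+ n)) →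
    sum t ≈ sum (λ i → t (i ↑ˡ n)) + sum (λ j → t (m ↑ʳ j))
  sum-+ zero    t = sym (+-identityˡ _)
  sum-+ (suc m) t = trans (+-congˡ (sum-+ m (t ∘ suc))) (sym (+-assoc _ _ _))

  sum-combine : ∀ m {n} (t : Vector Carrier (m ℕ.* n)) →
    sum t ≈ sum (λ (i : Fin m) → sum (λ (j : Fin n) → t (combine i j)))
  sum-combine zero    t = refl
  sum-combine (suc m) {n} t = trans (sum-+ n t) (+-congˡ (sum-combine m (λ j → t (n ↑ʳ j))))

  module ColumnReduction {n : ℕ} (t : (j : Fin n) → Fin.Fin′ j → Carrier) where
    open AbelianGroupProperties +-abelianGroup using () renaming (⁻¹-∙-comm to -‿+-comm)
    open RingProperties ring using (-‿distribʳ-*)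
    open CommutativeSemigroupProperties +-commutativeSemigroup using (interchange)
    open RelativeLinearAlgebra K (whole K)
    open Polynomials K using (y+[x-y]≈x)

    combination : ∀ {a} → Matrix a n → Matrix a n
    combination M (i , j) = lincomb (t j) (λ l → columns M (inject l)) i

    -- Right multiplication by the unitriangular matrix with entries - `t j l` above the diagonal.
    -- As `t` is independent of M, the same linear map acts on every codeword.
    reduce : ∀ {a} → Matrix a n → Matrix a n
    reduce M p = M p + - combination M p

    reduce-linear : ∀ {a} → IsLinear (reduce {a})
    reduce-linear = record
      { f-cong = λ u≋v (i , j) → +-cong (u≋v (i , j)) (-‿cong
          (lincomb-cong {c = t j} (λ _ → refl) (λ l i → u≋v (i , inject l)) i))
      ; f-+ = λ u v (i , j) → begin
          u (i , j) + v (i , j) + - combination (λ p → u p + v p) (i , j)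
            ≈⟨ +-congˡ (-‿cong (trans (sum-cong-≋ (λ l → distribˡ (t j l) _ _))
                 (∑-distrib-+ (λ l → t j l · u (i , inject l)) (λ l → t j l · v (i , inject l))))) ⟩
          u (i , j) + v (i , j) + - (combination u (i , j) + combination v (i , j))
            ≈⟨ +-congˡ (-‿+-comm _ _) ⟨
          u (i , j) + v (i , j) + (- combination u (i , j) + - combination v (i , j))
            ≈⟨ interchange _ _ _ _ ⟩
          reduce u (i , j) + reduce v (i , j) ∎
      ; f-· = λ c v (i , j) → begin
          c · v (i , j) + - combination (λ p → c · v p) (i , j)
            ≈⟨ +-congˡ (-‿cong (trans (sum-cong-≋ (λ l → x∙yz≈y∙xz (t j l) c _))
                 (sym (*-distribˡ-sum c (λ l → t j l · v (i , inject l)))))) ⟩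
          c · v (i , j) + - (c · combination v (i , j))
            ≈⟨ +-congˡ (-‿distribʳ-* c _) ⟩
          c · v (i , j) + c · - combination v (i , j)
            ≈⟨ distribˡ c _ _ ⟨
          c · reduce v (i , j) ∎
      }
      where open CommutativeSemigroupProperties *-commutativeSemigroup using (x∙yz≈y∙xz)

    -- Forward substitution, the invertibility of the unitriangular matrix: column j is its reduced
    -- version plus a combination of earlier columns, which are already known to lie in the span.
    columns∈span-reduced : ∀ {a} (M : Matrix a n) j → SpanOver (columns (reduce M)) (columns M j)
    columns∈span-reduced M j = go j (<-wellFounded j)
      where
      go : ∀ j → Acc Fin._<_ j → SpanOver (columns (reduce M)) (columns M j)
      go j (acc rec) = span-resp (λ i → y+[x-y]≈x (M (i , j)) (combination M (i , j)))
        (span-+ (span-lincomb {c = t j} _ (λ l → go (inject l) (rec (inject-< l))))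
                (span-∋ (columns (reduce M)) j))

    reduce≋𝟎⇒≋𝟎 : ∀ {a} (M : Matrix a n) → reduce M ≋ 𝟎 → M ≋ 𝟎
    reduce≋𝟎⇒≋𝟎 M R≋𝟎 (i , j) = let (c , _ , Mⱼ≋) = columns∈span-reduced M j in begin
      M (i , j)                      ≈⟨ Mⱼ≋ i ⟩
      lincomb c (columns (reduce M)) i ≈⟨ sum-cong-≋ (λ l → trans (*-congˡ (R≋𝟎 (i , l))) (zeroʳ (c l))) ⟩
      sum {n} (λ _ → 0#)             ≈⟨ sum-replicate-zero n ⟩
      0#                             ∎

    -- Columns further left have no more dots, so they also vanish at every cell of column j that
    -- lies outside the diagram.
    reduce-support : ∀ {a} (𝓕 : FerrersDiagram a n) {M : Matrix a n} →
      (∀ p → ¬ FerrersDiagram.Dot 𝓕 p → M p ≈ 0#) → ∀ p → ¬ FerrersDiagram.Dot 𝓕 p → reduce M p ≈ 0#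
    reduce-support 𝓕 {M} M≈0 (i , j) ¬dot = begin
      M (i , j) + - combination M (i , j)
        ≈⟨ +-cong (M≈0 (i , j) ¬dot) (-‿cong (trans
             (sum-cong-≋ (λ l → trans (*-congˡ (M≈0 (i , inject l) (λ dot → ¬dot (ℕ.≤-trans dot
               (γ-monotone (ℕ.<⇒≤ (inject-< l))))))) (zeroʳ (t j l))))
             (sum-replicate-zero (toℕ j)))) ⟩
      0# + - 0#  ≈⟨ -‿inverseʳ 0# ⟩
      0#         ∎
      where open FerrersDiagram 𝓕

  record Reduction {a n : ℕ} (M : Matrix a n) (r : ℕ) : Set where
    field
      coefficients : (j : Fin n) → Fin.Fin′ j → Carrier
      pivot        : Fin r → Fin n
      independent  : LinearlyIndependent (columns M ∘ pivot)

    open ColumnReduction coefficients using (reduce)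

    field
      reduce-pivot    : ∀ l → columns (reduce M) (pivot l) ≋ columns M (pivot l)
      reduce-nonpivot : ∀ j → columns (reduce M) j ≋ 𝟎 ⊎ ∃[ l ] pivot l ≡ j

  rank⇒reduction : ∀ {a n r} (M : Matrix a n) → HasRank M r → Reduction M r
  rank⇒reduction {a} {n} {r} M rankM = ≡.subst (Reduction M) pivot-count record
    { coefficients    = λ j → coefficient (P.dependent? j)
    ; pivot           = P.embed
    ; independent     = λ c → P.pivots-independent c _
    ; reduce-pivot    = λ l → subtract-pivot (P.dependent? (P.embed l)) (P.sound l)
    ; reduce-nonpivot = λ j → subtract-nonpivot (P.dependent? j)
    }
    where
    open RelativeLinearAlgebra K (whole K)
    open FiniteFieldProperties K using (_≟_)
    open GroupProperties +-group using (ε⁻¹≈ε)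
    module P = Pivots (λ u w → Fin.all? (λ i → u i ≟ w i)) (columns M)

    Dependent : Fin n → Set
    Dependent j = SpanOver (columns M ∘ inject {i = j}) (columns M j)

    -- A dependent column gets the coefficients of its dependence and thus becomes zero; a pivot
    -- gets zeros and stays. The decision is an argument so that the lemmas below can match on it.
    coefficient : ∀ {j} → Dec (Dependent j) → Fin.Fin′ j → Carrier
    coefficient (yes (c , _)) = c
    coefficient (no  _)       = λ _ → 0#

    subtracted : ∀ j → Dec (Dependent j) → Fin a → Carrier
    subtracted j d i = M (i , j) + - lincomb (coefficient d) (columns M ∘ inject) i

    subtract-pivot : ∀ {j} (d : Dec (Dependent j)) → ¬ Dependent j → subtracted j d ≋ columns M j
    subtract-pivot (yes j∈) j∉ = contradiction j∈ j∉
    subtract-pivot {j} (no _) _ i = trans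
      (+-congˡ (trans (-‿cong (lincomb-0 (columns M ∘ inject {i = j}) (λ _ → refl) i)) ε⁻¹≈ε))
      (+-identityʳ _)

    subtract-nonpivot : ∀ {j} (d : Dec (Dependent j)) → subtracted j d ≋ 𝟎 ⊎ ∃[ l ] P.embed l ≡ j
    subtract-nonpivot (yes (_ , _ , eq)) = inj₁ (λ i → trans (+-congʳ (eq i)) (-‿inverseʳ _))
    subtract-nonpivot (no j∉)            = inj₂ (P.complete j∉)

    open HasDimension rankM

    -- The pivot columns and the basis supplied by `rankM` are independent families that span the
    -- same column space.
    pivot-count : P.size ≡ r
    pivot-count = ℕ.≤-antisym
      (independent∧spanned⇒≤ P.pivots-independent
        (λ l → span⇒spanOver-whole K basis (spanning
          (spanOver-whole⇒span K (columns M) (span-∋ (columns M) (P.embed l))))))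
      (independent∧spanned⇒≤ {v = basis} (λ c _ → independent c)
        (λ l → span-trans P.pivots-spanning (span⇒spanOver-whole K (columns M) (basis∈ l))))

-- Expansion of a code over the subfield

module _ (m a : ℕ) where

  -- Row i becomes the m consecutive rows m i + l. Keeping each block together sends the top γ cells
  -- of a column to its top m γ cells.
  row : Fin a → Fin m → Fin (m ℕ.* a)
  row i l = Fin.cast (ℕ.*-comm a m) (combine i l)

  position : Fin (m ℕ.* a) → Fin a × Fin m
  position r = remQuot m (Fin.cast (ℕ.*-comm m a) r)

  row-position : ∀ r → uncurry row (position r) ≡ r
  row-position r = ≡.trans
    (≡.cong (Fin.cast _) (Fin.combine-remQuot {a} m (Fin.cast (ℕ.*-comm m a) r)))
    (Fin.cast-involutive (ℕ.*-comm a m) (ℕ.*-comm m a) r)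

  position-row : ∀ i l → position (row i l) ≡ (i , l)
  position-row i l = ≡.trans
    (≡.cong (remQuot m) (Fin.cast-involutive (ℕ.*-comm m a) (ℕ.*-comm a m) (combine i l)))
    (Fin.remQuot-combine i l)

  row-< : ∀ i l {g} → toℕ i ℕ.< g → toℕ (row i l) ℕ.< m ℕ.* g
  row-< i l {g} i<g = begin-strict
    toℕ (row i l)             ≡⟨ Fin.toℕ-cast _ (combine i l) ⟩
    toℕ (combine i l)         ≡⟨ Fin.toℕ-combine i l ⟩
    m ℕ.* toℕ i ℕ.+ toℕ l     <⟨ ℕ.+-monoʳ-< (m ℕ.* toℕ i) (Fin.toℕ<n l) ⟩
    m ℕ.* toℕ i ℕ.+ m         ≡⟨ ℕ.+-comm _ m ⟩
    m ℕ.+ m ℕ.* toℕ i         ≡⟨ ℕ.*-suc m (toℕ i) ⟨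
    m ℕ.* suc (toℕ i)         ≤⟨ ℕ.*-monoʳ-≤ m i<g ⟩
    m ℕ.* g                   ∎
    where open ℕ.≤-Reasoning

module Expansion {Q q m : ℕ} (K : FiniteField Q) (S : Subfield K q)
  (β : Vector (⊤ → FiniteField.Carrier K) m)
  (β-independent : RelativeLinearAlgebra.IndependentOver K S β)
  (β-spanning : ∀ u → RelativeLinearAlgebra.SpanOver K S β u) where
  open FiniteField K hiding (_≉_; zero)
  open LinearCombinations K
  open LinearMaps K
  open SemiringSum semiring
  open Subfield S using (toField)
  open import Relation.Binary.Reasoning.Setoid ≈-setoid
  open GroupProperties +-group using () renaming (x∙y⁻¹≈ε⇒x≈y to x-y≈0⇒x≈y)

  module F = FiniteField toField
  module LF = LinearAlgebra toField
  module LK = LinearAlgebra K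
  module KK = RelativeLinearAlgebra K (whole K)
  module FF = RelativeLinearAlgebra toField (whole toField)
  open LK using (_≋_; 𝟎; lincomb; columns)

  coordinates : Carrier → Fin m → F.Carrier
  coordinates x l = let (c , c∈ , _) = β-spanning (λ _ → x) in c l , c∈ l

  coordinates-correct : ∀ x → lincomb (proj₁ ∘ coordinates x) β tt ≈ x
  coordinates-correct x = let (_ , _ , x≈) = β-spanning (λ _ → x) in sym (x≈ tt)

  module Contraction (a : ℕ) where

    contract : (Fin (m ℕ.* a) → F.Carrier) → Fin a → Carrier
    contract w i = lincomb (λ l → proj₁ (w (row m a i l))) β tt

    contract-cong : ∀ {v w} → v LF.≋ w → contract v ≋ contract w
    contract-cong v≋w i = lincomb-cong {v = β} (λ l → v≋w (row m a i l)) (λ _ _ → refl) tt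

    contract-+ : ∀ v w → contract (λ r → v r F.+ w r) ≋ (λ i → contract v i + contract w i)
    contract-+ v w i = lincomb-+ (λ l → proj₁ (v (row m a i l))) (λ l → proj₁ (w (row m a i l))) β tt

    contract-· : ∀ c w → contract (λ r → c F.· w r) ≋ (λ i → proj₁ c · contract w i)
    contract-· c w i = lincomb-· (proj₁ c) (λ l → proj₁ (w (row m a i l))) β tt

    contract-𝟎 : contract LF.𝟎 ≋ 𝟎
    contract-𝟎 i = lincomb-0 β (λ _ → refl) tt

    contract-lincomb : ∀ {k} (c : Vector F.Carrier k) (w : Vector (Fin (m ℕ.* a) → F.Carrier) k) →
      contract (LF.lincomb c w) ≋ lincomb (proj₁ ∘ c) (contract ∘ w)
    contract-lincomb {zero}  c w = contract-𝟎
    contract-lincomb {suc k} c w i = begin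
      contract (λ r → c zero F.· w zero r F.+ LF.lincomb (c ∘ suc) (w ∘ suc) r) i
        ≈⟨ contract-+ (λ r → c zero F.· w zero r) (LF.lincomb (c ∘ suc) (w ∘ suc)) i ⟩
      contract (λ r → c zero F.· w zero r) i + contract (LF.lincomb (c ∘ suc) (w ∘ suc)) i
        ≈⟨ +-cong (contract-· (c zero) (w zero) i) (contract-lincomb (c ∘ suc) (w ∘ suc) i) ⟩
      proj₁ (c zero) · contract (w zero) i + lincomb (proj₁ ∘ c ∘ suc) (contract ∘ w ∘ suc) i ∎

    -- The differences of the coordinates within block i form a relation of `β` over the subfield.
    -- Working block by block also serves the support condition.
    contract-≈ : ∀ v w i → contract v i ≈ contract w i → ∀ l → v (row m a i l) F.≈ w (row m a i l)
    contract-≈ v w i eq l = x-y≈0⇒x≈y _ _ (β-independent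
      (λ l → proj₁ (v (row m a i l)) + - proj₁ (w (row m a i l)))
      (λ l → proj₂ (v (row m a i l) F.+ F.- w (row m a i l)))
      (lincomb-- (λ l → proj₁ (v (row m a i l))) (λ l → proj₁ (w (row m a i l))) β (λ _ → eq)) l)

    contract-injective : ∀ {v w} → contract v ≋ contract w → v LF.≋ w
    contract-injective {v} {w} eq r = let (i , l) = position m a r in
      ≡.subst (λ r → v r F.≈ w r) (row-position m a r) (contract-≈ v w i (eq i) l)

    expand : (Fin a → Carrier) → Fin (m ℕ.* a) → F.Carrier
    expand u r = uncurry (coordinates ∘ u) (position m a r)

    contract-expand : ∀ u → contract (expand u) ≋ u
    contract-expand u i = trans
      (sum-cong-≋ (λ l → *-congʳ (reflexive
        (≡.cong (proj₁ ∘ uncurry (coordinates ∘ u)) (position-row m a i l)))))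
      (coordinates-correct (u i))

    module _ {n : ℕ} where

      contractᴹ : LF.Matrix (m ℕ.* a) n → LK.Matrix a n
      contractᴹ N (i , j) = contract (LF.columns N j) i

      contractᴹ-cong : ∀ {N N′} → N LF.≋ N′ → contractᴹ N ≋ contractᴹ N′
      contractᴹ-cong {N} {N′} N≋N′ (i , j) =
        contract-cong {v = LF.columns N j} {w = LF.columns N′ j} (λ r → N≋N′ (r , j)) i

      contractᴹ-𝟎 : contractᴹ LF.𝟎 ≋ 𝟎
      contractᴹ-𝟎 (i , j) = contract-𝟎 i

      contractᴹ-injective : ∀ {N N′} → contractᴹ N ≋ contractᴹ N′ → N LF.≋ N′
      contractᴹ-injective {N} {N′} eq (r , j) =
        contract-injective {v = LF.columns N j} {w = LF.columns N′ j} (λ i → eq (i , j)) r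

      expandᴹ : LK.Matrix a n → LF.Matrix (m ℕ.* a) n
      expandᴹ M (r , j) = expand (columns M j) r

      contractᴹ-expandᴹ : ∀ M → contractᴹ (expandᴹ M) ≋ M
      contractᴹ-expandᴹ M (i , j) = contract-expand (columns M j) i

  -- The expanded code and its parameters

  module _ {a n : ℕ} (𝓕 : FerrersDiagram a n) {k δ : ℕ} {C : Pred (LK.Matrix a n) 0ℓ}
           (isCode : LK.IsFerrersCode 𝓕 k δ C)
           (reduction : Reduction
             (proj₁ (LK.HasMinimumRankDistance.attained (LK.IsFerrersCode.distance isCode))) δ) where
    open Contraction a
    open LK.IsFerrersCode isCode
    open LK.IsSubspace isSubspace
    open LK.HasDimension dimension
    open LK.HasMinimumRankDistance distance

    M₀ : LK.Matrix a n
    M₀ = proj₁ attained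

    open Reduction reduction hiding (independent)
    open ColumnReduction coefficients
    open IsLinear (reduce-linear {a})

    -- A preimage under contraction instead of an image under `expandᴹ`: the closure properties then
    -- follow from linearity of `contract` and `reduce`.
    C′ : Pred (LF.Matrix (m ℕ.* a) n) 0ℓ
    C′ N = ∃[ M ] (M ∈ C × contractᴹ N ≋ reduce M)

    C′-subspace : LF.IsSubspace C′
    C′-subspace = record
      { resp     = λ {u} {v} u≋v (M , M∈ , eq) → M , M∈ , λ p →
          trans (sym (contractᴹ-cong {N = u} {N′ = v} u≋v p)) (eq p)
      ; 0-closed = 𝟎 , 0-closed , λ p → trans (contractᴹ-𝟎 p) (sym (f-𝟎 p))
      ; +-closed = λ {u} {v} (M , M∈ , eq) (M′ , M′∈ , eq′) → _ , +-closed M∈ M′∈ , λ (i , j) →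
          trans (contract-+ (LF.columns u j) (LF.columns v j) i)
            (trans (+-cong (eq (i , j)) (eq′ (i , j))) (sym (f-+ M M′ (i , j))))
      ; ·-closed = λ c {v} (M , M∈ , eq) → _ , ·-closed (proj₁ c) M∈ , λ (i , j) →
          trans (contract-· c (LF.columns v j) i)
            (trans (*-congˡ (eq (i , j))) (sym (f-· (proj₁ c) M (i , j))))
      }

    contractᴹ-≋𝟎 : ∀ (N : LF.Matrix (m ℕ.* a) n) → contractᴹ N ≋ 𝟎 → N LF.≋ LF.𝟎
    contractᴹ-≋𝟎 N eq = contractᴹ-injective {N = N} {N′ = LF.𝟎}
      (λ p → trans (eq p) (sym (contractᴹ-𝟎 p)))

    -- As in the tower law for degrees, the products of the basis of K over F with a K-basis of the
    -- code form an F-basis of the code.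
    product : Fin (m ℕ.* k) → LK.Matrix a n
    product t p = β (quotient k t) tt · basis (remainder {m} k t) p

    basis′ : Vector (LF.Matrix (m ℕ.* a) n) (m ℕ.* k)
    basis′ t = expandᴹ (reduce (product t))

    contract-combination : ∀ c →
      contractᴹ (LF.lincomb c basis′) ≋ reduce (lincomb (proj₁ ∘ c) product)
    contract-combination c (i , j) = begin
      contract (LF.lincomb c (λ t → LF.columns (basis′ t) j)) i
        ≈⟨ contract-lincomb c (λ t → LF.columns (basis′ t) j) i ⟩
      lincomb (proj₁ ∘ c) (λ t → contract (LF.columns (basis′ t) j)) i
        ≈⟨ sum-cong-≋ (λ t → *-congˡ (contractᴹ-expandᴹ (reduce (product t)) (i , j))) ⟩
      lincomb (proj₁ ∘ c) (reduce ∘ product) (i , j)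
        ≈⟨ f-lincomb (proj₁ ∘ c) product (i , j) ⟨
      reduce (lincomb (proj₁ ∘ c) product) (i , j) ∎

    product-lincomb : ∀ c p → lincomb c product p ≈
      lincomb (λ i → lincomb (λ l → c (combine l i)) β tt) basis p
    product-lincomb c p = begin
      sum (λ t → c t · product t p)
        ≈⟨ sum-combine m {k} (λ t → c t · product t p) ⟩
      sum (λ (l : Fin m) → sum (λ (i : Fin k) → c (combine l i) · product (combine l i) p))
        ≈⟨ ∑-comm (λ (l : Fin m) (i : Fin k) → c (combine l i) · product (combine l i) p) ⟩
      sum (λ (i : Fin k) → sum (λ (l : Fin m) → c (combine l i) · product (combine l i) p))
        ≈⟨ sum-cong-≋ (λ i → trans
             (sum-cong-≋ (λ l → trans (*-congˡ (product-combine l i)) (sym (*-assoc _ _ _))))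
             (sym (*-distribʳ-sum (basis i p) (λ l → c (combine l i) · β l tt)))) ⟩
      sum (λ (i : Fin k) → sum (λ (l : Fin m) → c (combine l i) · β l tt) · basis i p) ∎
      where
      product-combine : ∀ l i → product (combine l i) p ≈ β l tt · basis i p
      product-combine l i = reflexive
        (≡.cong (λ (l , i) → β l tt · basis i p) (Fin.remQuot-combine {m} l i))

    C′-dimension : LF.HasDimension C′ (m ℕ.* k)
    C′-dimension = record
      { basis       = basis′
      ; basis∈      = λ t → product t , ·-closed _ (basis∈ _) , contractᴹ-expandᴹ (reduce (product t))
      -- Grouped by codewords of `basis`, the relation has coefficients in K, which vanish by
      -- independence over K. Each of them is an F-combination of `β`, whose coefficients vanish in
      -- turn.
      ; independent = λ c Σ≋𝟎 t → ≡.subst (λ t → c t F.≈ F.0#) (Fin.combine-remQuot {m} k t)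
          (let i = remainder {m} k t in
           β-independent (λ l → proj₁ (c (combine l i))) (λ l → proj₂ (c (combine l i)))
             (λ _ → independent (λ i → lincomb (λ l → proj₁ (c (combine l i))) β tt)
               (λ p → trans (sym (product-lincomb (proj₁ ∘ c) p)) (product-relation c Σ≋𝟎 p)) i)
             (quotient k t))
      ; spanning    = λ {N} (M , M∈ , N≋) →
          let (d , M≋) = spanning M∈
              c : Vector F.Carrier (m ℕ.* k)
              c t = coordinates (d (remainder {m} k t)) (quotient k t)
              M≋′ : M ≋ lincomb (proj₁ ∘ c) product
              M≋′ p = trans (M≋ p) (sym (trans (product-lincomb (proj₁ ∘ c) p) (lincomb-cong {v = basis}
                (λ i → trans
                  (sum-cong-≋ (λ l → *-congʳ (reflexive
                    (≡.cong (λ (l , i) → proj₁ (coordinates (d i) l)) (Fin.remQuot-combine {m} l i)))))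
                  (coordinates-correct (d i)))
                (λ _ _ → refl) p)))
          in c , contractᴹ-injective {N = N} {N′ = LF.lincomb c basis′}
               (λ p → trans (N≋ p) (trans (f-cong M≋′ p) (sym (contract-combination c p))))
      }
      where
      product-relation : ∀ c → LF.lincomb c basis′ LF.≋ LF.𝟎 → lincomb (proj₁ ∘ c) product ≋ 𝟎
      product-relation c Σ≋𝟎 = reduce≋𝟎⇒≋𝟎 (lincomb (proj₁ ∘ c) product) (λ p →
        trans (sym (contract-combination c p))
        (trans (contractᴹ-cong {N = LF.lincomb c basis′} {N′ = LF.𝟎} Σ≋𝟎 p) (contractᴹ-𝟎 p)))

    N₀ : LF.Matrix (m ℕ.* a) n
    N₀ = expandᴹ (reduce M₀)

    contract-N₀ : contractᴹ N₀ ≋ reduce M₀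
    contract-N₀ = contractᴹ-expandᴹ (reduce M₀)

    -- The columns of `N₀` off the pivots are zero. An F-relation among the pivot columns contracts
    -- to a K-relation among independent columns of `M₀`, so it is trivial.
    N₀-rank : LF.HasRank N₀ δ
    N₀-rank = record
      { basis       = pivots
      ; basis∈      = λ l → spanOver-whole⇒span toField (LF.columns N₀) {pivots l}
          (FF.span-∋ (LF.columns N₀) (pivot l))
      ; independent = λ c Σ≋𝟎 → Reduction.independent reduction (proj₁ ∘ c) (λ i → begin
          lincomb (proj₁ ∘ c) (columns M₀ ∘ pivot) i
            ≈⟨ sum-cong-≋ (λ l → *-congˡ (trans (contract-N₀ (i , pivot l)) (reduce-pivot l i))) ⟨
          lincomb (proj₁ ∘ c) (contract ∘ pivots) i
            ≈⟨ contract-lincomb c pivots i ⟨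
          contract (LF.lincomb c pivots) i
            ≈⟨ contract-cong {v = LF.lincomb c pivots} {w = LF.𝟎} Σ≋𝟎 i ⟩
          contract LF.𝟎 i
            ≈⟨ contract-𝟎 i ⟩
          0# ∎)
      ; spanning    = λ {w} w∈ → spanOver-whole⇒span toField pivots {w}
          (FF.span-trans {u = w} column∈ (span⇒spanOver-whole toField (LF.columns N₀) {w} w∈))
      }
      where
      pivots : Vector (Fin (m ℕ.* a) → F.Carrier) δ
      pivots = LF.columns N₀ ∘ pivot
      column∈ : ∀ j → FF.SpanOver pivots (LF.columns N₀ j)
      column∈ j with reduce-nonpivot j
      ... | inj₁ ≋𝟎       = FF.span-resp {u = LF.𝟎} {w = LF.columns N₀ j}
              (contract-injective {v = LF.𝟎} {w = LF.columns N₀ j} (λ i →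
                trans (contract-𝟎 i) (sym (trans (contract-N₀ (i , j)) (≋𝟎 i))))) FF.span-𝟎
      ... | inj₂ (l , eq) = ≡.subst (λ j → FF.SpanOver pivots (LF.columns N₀ j)) eq (FF.span-∋ pivots l)

    C′-distance : LF.HasMinimumRankDistance C′ δ
    C′-distance = record
      { attained = N₀ , (M₀ , proj₁ (proj₂ attained) , contract-N₀) , N₀≉𝟎 , N₀-rank
      ; minimal  = λ {N} {r} (M , M∈ , N≋) N≉𝟎 rankN →
          let (r′ , rankM) = rank-exists K M
              open LF.HasDimension rankN using () renaming (basis to basisN; spanning to spanningN)
              open LK.HasDimension rankM using () renaming (basis∈ to basisM∈; independent to independentM)
              -- This is why expansion never lowers the rank: an F-basis of the column space of N
              -- contracts to r vectors whose K-span contains the columns of `reduce M`, hence those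
              -- of M.
              reduced∈ : ∀ j → KK.SpanOver (contract ∘ basisN) (columns (reduce M) j)
              reduced∈ j =
                let (c , Nⱼ≋) = spanningN {LF.columns N j} (spanOver-whole⇒span toField (LF.columns N)
                                  {LF.columns N j} (FF.span-∋ (LF.columns N) j))
                in proj₁ ∘ c , _ , λ i → trans (sym (N≋ (i , j)))
                     (trans (contract-cong {v = LF.columns N j} {w = LF.lincomb c basisN} Nⱼ≋ i)
                            (contract-lincomb c basisN i))
          in ℕ.≤-trans
            (minimal M∈
              (λ M≋𝟎 → N≉𝟎 (contractᴹ-≋𝟎 N (λ p → trans (N≋ p) (trans (f-cong M≋𝟎 p) (f-𝟎 p)))))
              rankM)
            (KK.independent∧spanned⇒≤ (λ c _ → independentM c)
              (λ l → KK.span-trans reduced∈ (KK.span-trans (columns∈span-reduced M)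
                (span⇒spanOver-whole K (columns M) (basisM∈ l)))))
      }
      where
      N₀≉𝟎 : ¬ (N₀ LF.≋ LF.𝟎)
      N₀≉𝟎 N₀≋𝟎 = proj₁ (proj₂ (proj₂ attained)) (reduce≋𝟎⇒≋𝟎 M₀ (λ p →
        trans (sym (contract-N₀ p))
        (trans (contractᴹ-cong {N = N₀} {N′ = LF.𝟎} N₀≋𝟎 p) (contractᴹ-𝟎 p))))

    C′-isFerrersCode : .{{_ : NonZero m}} → LF.IsFerrersCode (scale m 𝓕) (m ℕ.* k) δ C′
    C′-isFerrersCode = record
      { isSubspace = C′-subspace
      ; dimension  = C′-dimension
      ; distance   = C′-distance
      ; support    = λ {N} → C′-support {N}
      }
      where
      C′-support : ∀ {N} → N ∈ C′ → ∀ p → ¬ FerrersDiagram.Dot (scale m 𝓕) p → N p F.≈ F.0#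
      C′-support {N} (M , M∈ , N≋) (r , j) ¬dot = let (i , l) = position m a r in
        ≡.subst (λ r → N (r , j) F.≈ F.0#) (row-position m a r)
          (contract-≈ (LF.columns N j) LF.𝟎 i
            (trans (N≋ (i , j)) (trans
              -- If row i had a dot in column j of `𝓕`, its whole block of m rows, including r,
              -- would lie inside the scaled diagram.
              (reduce-support 𝓕 (support M∈) (i , j) (λ i<γ → ¬dot
                (≡.subst (λ r → toℕ r ℕ.< m ℕ.* FerrersDiagram.γ 𝓕 j) (row-position m a r)
                  (row-< m a i l i<γ))))
              (sym (contract-𝟎 i))))
            l)

-- Allows q to be matched as 2 + u, the form in which the polynomials for the fixed field are
-- written.
primePower≥2 : ∀ {q} → IsPrimePower q → 2 ℕ.≤ q
primePower≥2 (p , e , pr , 1≤e , ≡.refl) =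
  ℕ.≤-trans (ℕ.nonTrivial⇒n>1 p {{prime⇒nonTrivial pr}})
    (≡.subst (ℕ._≤ p ℕ.^ e) (ℕ.*-identityʳ p) (ℕ.^-monoʳ-≤ p {{prime⇒nonZero pr}} 1≤e))

open import Data.Nat.Base using (_*_; _^_)

theorem3p1 : (q m : ℕ) .{{_ : NonZero m}} → IsPrimePower q →
    {a n : ℕ} (𝓕 : FerrersDiagram a n) (k δ : ℕ) →
    FerrersCode 𝓕 k δ (q ^ m) → FerrersCode (scale m 𝓕) (m * k) δ q
theorem3p1 q m q-pp 𝓕 k δ X with primePower≥2 q-pp
theorem3p1 (suc (suc u)) m (p , e , pr , _ , q≡p^e) 𝓕 k δ X | s≤s (s≤s z≤n) = record
  { 𝔽             = Subfield.toField S
  ; code          = C′ 𝓕 isFerrersCode reduction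
  ; isFerrersCode = C′-isFerrersCode 𝓕 isFerrersCode reduction
  }
  where
  open FerrersCode X
  S : Subfield 𝔽 (2 ℕ.+ u)
  S = Polynomials.fixedField 𝔽 {p} {e} pr m u q≡p^e ≡.refl
  open RelativeLinearAlgebra 𝔽 S using (IndependentOver; SpanOver; relativeBasis)
  basis : ∃[ β ] (IndependentOver {I = ⊤} {m} β × (∀ u → SpanOver β u))
  basis = relativeBasis ≡.refl
  open Expansion 𝔽 S (proj₁ basis) (proj₁ (proj₂ basis)) (proj₂ (proj₂ basis))
  open LinearMaps 𝔽 using (Reduction; rank⇒reduction)
  open LinearAlgebra 𝔽 using (module IsFerrersCode; module HasMinimumRankDistance)
  open HasMinimumRankDistance (IsFerrersCode.distance isFerrersCode) using (attained)
  reduction : Reduction (proj₁ attained) δ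
  reduction = rank⇒reduction (proj₁ attained) (proj₂ (proj₂ (proj₂ attained)))
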